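{- There is a function $f$ such that, for each $\tau\ge 2$, the number of irreducible facet inducing Steiner graphs $(G,T)$ with $|T|=\tau$ is, up to isomorphism, bounded by $f(\tau)$.
   Context: Graphs are finite and have no loops or multiple edges. A Steiner graph $(G,T)$ consists of a connected graph $G$ with node set $V(G)$ and edge set $E(G)$ and a set $T\subseteq V(G)$ of terminals with $|T|\ge 2$. An isomorphism of Steiner graphs is a graph isomorphism mapping the terminal set onto the terminal set. For $S\subseteq V(G)$, $\delta(S)$ is the set of edges with exactly one endnode in $S$. The cut $\delta(S)$ is a $T$-Steiner cut if $T\cap S\neq\varnothing$ and $T\setminus S\neq\varnothing$. The $T$-Steiner cut dominant is $\mathrm{CUT}_+(G,T)=\mathrm{conv}\{\chi(\delta(S)) : \delta(S)\text{ a }T\text{ -Steiner cut}\}+\mathbb{R}_{\ge 0}^{E(G)}$, where $\chi(\cdot)$ denotes the $0/1$ incidence vector in $\mathbb{R}^{E(G)}$. For $c\in\mathbb{R}^{E(G)}$ and $F\subseteq E(G)$, $c(F)=\sum_{e\in F}c_e$. For a nonnegative vector $c$, $\gamma_c(G,T)$ is the minimum of $c(\delta(S))$ over all $T$-Steiner cuts. A vector is in minimum integer form if its components are nonnegative integers with greatest common divisor one. A vector $c$ provides facet weights for $(G,T)$ if $c$ is in minimum integer form, $c_e>0$ for all $e\in E(G)$, $\gamma_c(G,T)>0$, and $cx\ge\gamma_c(G,T)$ defines a facet of $\mathrm{CUT}_+(G,T)$; $(G,T)$ is facet inducing if it has facet weights. A facet inducing Steiner graph $(G,T)$ is irreducible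 if $G$ has no cut node (a node $w$ such that $G\setminus w$, the graph with $w$ and its incident edges removed, is disconnected) and no node in $V(G)\setminus T$ has degree two. -}

module Defs where

open import Data.Bool.Base using (if_then_else_; _xor_)
open import Data.Fin.Base as Fin using (Fin)
open import Data.Fin.Subset using (Subset; _∈_; _∉_; _∩_; _─_; ∁; ⁅_⁆; ⊤; ∣_∣; Nonempty)
open import Data.Integer.Base using (+_)
open import Data.Nat.Base as ℕ using (ℕ; zero; suc)
import Data.Nat.Properties as ℕ
open import Data.Nat.GCD using (gcd)
open import Data.Product.Base using (Σ; ∃; ∃-syntax; _×_; _,_)
open import Data.Rational.Base as ℚ using (ℚ; 0ℚ; 1ℚ; ½)
import Data.Rational.Properties as ℚ
open import Data.Rational.Solver using (module +-*-Solver)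
open import Data.Sum.Base using (_⊎_)
open import Data.Vec.Base using (lookup; tabulate)
open import Data.Vec.Functional using (Vector; foldr)
open import Function.Bundles using (_↔_; _⇔_; Inverse)
open import Relation.Binary.Construct.Closure.ReflexiveTransitive using (Star)
open import Relation.Binary.PropositionalEquality
open import Relation.Nullary using (¬_)

------------------------------------------------------------------------
-- Real numbers: Cauchy sequences of rationals, with the induced
-- equality and order.

Cauchy : (ℕ → ℚ) → Set
Cauchy x = ∀ ε → 0ℚ ℚ.< ε →
  ∃[ N ] (∀ m n → N ℕ.≤ m → N ℕ.≤ n → ℚ.∣ x m ℚ.- x n ∣ ℚ.< ε)

record ℝ : Set where
  field
    seq    : ℕ → ℚ
    cauchy : Cauchy seq

open ℝ public

infix 4 _≃_ _≤_

_≃_ : ℝ → ℝ → Set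
x ≃ y = ∀ ε → 0ℚ ℚ.< ε → ∃[ N ] (∀ n → N ℕ.≤ n → ℚ.∣ seq x n ℚ.- seq y n ∣ ℚ.< ε)

-- The slack ε is essential: termwise (even eventual) comparison of the
-- sequences would not respect _≃_.
_≤_ : ℝ → ℝ → Set
x ≤ y = ∀ ε → 0ℚ ℚ.< ε → ∃[ N ] (∀ n → N ℕ.≤ n → seq x n ℚ.< seq y n ℚ.+ ε)

fromℚ : ℚ → ℝ
fromℚ q = record
  { seq    = λ _ → q
  ; cauchy = λ ε 0<ε → 0 , λ _ _ _ _ →
      subst (λ d → ℚ.∣ d ∣ ℚ.< ε) (sym (ℚ.+-inverseʳ q)) 0<ε
  }

fromℕ : ℕ → ℝ
fromℕ n = fromℚ (+ n ℚ./ 1)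

0ℝ 1ℝ : ℝ
0ℝ = fromℕ 0
1ℝ = fromℕ 1

private
  abstract

    half : ∀ {ε} → 0ℚ ℚ.< ε → 0ℚ ℚ.< ½ ℚ.* ε
    half {ε} 0<ε = subst (ℚ._< ½ ℚ.* ε) (ℚ.*-zeroʳ ½) (ℚ.*-monoʳ-<-pos ½ 0<ε)

    half+half : ∀ ε → ½ ℚ.* ε ℚ.+ ½ ℚ.* ε ≡ ε
    half+half ε = trans (sym (ℚ.*-distribʳ-+ ε ½ ½)) (ℚ.*-identityˡ ε)

    +-cauchy : ∀ {x y} → Cauchy x → Cauchy y → Cauchy (λ n → x n ℚ.+ y n)
    +-cauchy {x} {y} cx cy ε 0<ε with cx (½ ℚ.* ε) (half 0<ε) | cy (½ ℚ.* ε) (half 0<ε)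
    ... | M , hx | N , hy = M ℕ.⊔ N , λ m n m≥ n≥ → begin-strict
      ℚ.∣ (x m ℚ.+ y m) ℚ.- (x n ℚ.+ y n) ∣
        ≡⟨ cong ℚ.∣_∣ (rearrange (x m) (y m) (x n) (y n)) ⟩
      ℚ.∣ (x m ℚ.- x n) ℚ.+ (y m ℚ.- y n) ∣
        ≤⟨ ℚ.∣p+q∣≤∣p∣+∣q∣ (x m ℚ.- x n) (y m ℚ.- y n) ⟩
      ℚ.∣ x m ℚ.- x n ∣ ℚ.+ ℚ.∣ y m ℚ.- y n ∣
        <⟨ ℚ.+-mono-< (hx m n (ℕ.m⊔n≤o⇒m≤o M N m≥) (ℕ.m⊔n≤o⇒m≤o M N n≥))
                      (hy m n (ℕ.m⊔n≤o⇒n≤o M N m≥) (ℕ.m⊔n≤o⇒n≤o M N n≥)) ⟩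
      ½ ℚ.* ε ℚ.+ ½ ℚ.* ε
        ≡⟨ half+half ε ⟩
      ε ∎
      where
      open ℚ.≤-Reasoning
      open +-*-Solver
      rearrange : ∀ a b c d → (a ℚ.+ b) ℚ.- (c ℚ.+ d) ≡ (a ℚ.- c) ℚ.+ (b ℚ.- d)
      rearrange = solve 4 (λ a b c d → (a :+ b) :- (c :+ d) := (a :- c) :+ (b :- d)) refl

    bounded : ∀ {x} → Cauchy x →
      ∃[ B ] (0ℚ ℚ.< B × ∃[ N ] (∀ n → N ℕ.≤ n → ℚ.∣ x n ∣ ℚ.≤ B))
    bounded {x} cx with cx 1ℚ (ℚ.positive⁻¹ 1ℚ)
    ... | N , h = 1ℚ ℚ.+ ℚ.∣ x N ∣
      , ℚ.+-mono-<-≤ (ℚ.positive⁻¹ 1ℚ) (ℚ.0≤∣p∣ (x N))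
      , N , λ n n≥ → begin
        ℚ.∣ x n ∣
          ≡⟨ cong ℚ.∣_∣ (split (x n) (x N)) ⟩
        ℚ.∣ (x n ℚ.- x N) ℚ.+ x N ∣
          ≤⟨ ℚ.∣p+q∣≤∣p∣+∣q∣ (x n ℚ.- x N) (x N) ⟩
        ℚ.∣ x n ℚ.- x N ∣ ℚ.+ ℚ.∣ x N ∣
          ≤⟨ ℚ.+-monoˡ-≤ ℚ.∣ x N ∣ (ℚ.<⇒≤ (h n N n≥ ℕ.≤-refl)) ⟩
        1ℚ ℚ.+ ℚ.∣ x N ∣ ∎
      where
      open ℚ.≤-Reasoning
      open +-*-Solver
      split : ∀ a b → a ≡ (a ℚ.- b) ℚ.+ b
      split = solve 2 (λ a b → a := (a :- b) :+ b) refl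

    divide : ∀ {B η} → 0ℚ ℚ.< B → 0ℚ ℚ.< η → ∃[ δ ] (0ℚ ℚ.< δ × B ℚ.* δ ≡ η)
    divide {B} {η} 0<B 0<η = δ , ℚ.positive⁻¹ δ , (begin
      B ℚ.* (ℚ.1/ B ℚ.* η)   ≡⟨ sym (ℚ.*-assoc B (ℚ.1/ B) η) ⟩
      (B ℚ.* ℚ.1/ B) ℚ.* η   ≡⟨ cong (ℚ._* η) (ℚ.*-inverseʳ B) ⟩
      1ℚ ℚ.* η               ≡⟨ ℚ.*-identityˡ η ⟩
      η ∎)
      where
      open ≡-Reasoning
      instance
        B>0 : ℚ.Positive B
        B>0 = ℚ.positive 0<B
        η>0 : ℚ.Positive η
        η>0 = ℚ.positive 0<η
        B≢0 : ℚ.NonZero B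
        B≢0 = ℚ.pos⇒nonZero B
        1/B>0 : ℚ.Positive (ℚ.1/ B)
        1/B>0 = ℚ.1/pos⇒pos B
      δ : ℚ
      δ = ℚ.1/ B ℚ.* η
      instance
        δ>0 : ℚ.Positive δ
        δ>0 = ℚ.pos*pos⇒pos (ℚ.1/ B) η

    scale : ∀ {B p q δ} → 0ℚ ℚ.< B → ℚ.∣ p ∣ ℚ.≤ B → ℚ.∣ q ∣ ℚ.< δ →
            ℚ.∣ p ℚ.* q ∣ ℚ.< B ℚ.* δ
    scale {B} {p} {q} {δ} 0<B p≤B q<δ = begin-strict
      ℚ.∣ p ℚ.* q ∣          ≡⟨ ℚ.∣p*q∣≡∣p∣*∣q∣ p q ⟩
      ℚ.∣ p ∣ ℚ.* ℚ.∣ q ∣    ≤⟨ ℚ.*-monoʳ-≤-nonNeg ℚ.∣ q ∣ ⦃ ℚ.nonNegative (ℚ.0≤∣p∣ q) ⦄ p≤B ⟩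
      B ℚ.* ℚ.∣ q ∣          <⟨ ℚ.*-monoʳ-<-pos B ⦃ ℚ.positive 0<B ⦄ q<δ ⟩
      B ℚ.* δ ∎
      where open ℚ.≤-Reasoning

    product-rearrange : ∀ a b c d →
      a ℚ.* b ℚ.- c ℚ.* d ≡ a ℚ.* (b ℚ.- d) ℚ.+ d ℚ.* (a ℚ.- c)
    product-rearrange = solve 4 (λ a b c d →
      a :* b :- c :* d := a :* (b :- d) :+ d :* (a :- c)) refl
      where open +-*-Solver

    product-estimate : ∀ {A B α β η} a b c d → 0ℚ ℚ.< A → 0ℚ ℚ.< B →
      A ℚ.* α ≡ η → B ℚ.* β ≡ η →
      ℚ.∣ a ∣ ℚ.≤ A → ℚ.∣ d ∣ ℚ.≤ B → ℚ.∣ b ℚ.- d ∣ ℚ.< α → ℚ.∣ a ℚ.- c ∣ ℚ.< β →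
      ℚ.∣ a ℚ.* b ℚ.- c ℚ.* d ∣ ℚ.< η ℚ.+ η
    product-estimate {A} {B} {α} {β} {η} a b c d 0<A 0<B Aα Bβ a≤A d≤B b-d<α a-c<β =
      begin-strict
      ℚ.∣ a ℚ.* b ℚ.- c ℚ.* d ∣
        ≡⟨ cong ℚ.∣_∣ (product-rearrange a b c d) ⟩
      ℚ.∣ a ℚ.* (b ℚ.- d) ℚ.+ d ℚ.* (a ℚ.- c) ∣
        ≤⟨ ℚ.∣p+q∣≤∣p∣+∣q∣ (a ℚ.* (b ℚ.- d)) (d ℚ.* (a ℚ.- c)) ⟩
      ℚ.∣ a ℚ.* (b ℚ.- d) ∣ ℚ.+ ℚ.∣ d ℚ.* (a ℚ.- c) ∣
        <⟨ ℚ.+-mono-< (scale {A} {a} {b ℚ.- d} {α} 0<A a≤A b-d<α)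
                      (scale {B} {d} {a ℚ.- c} {β} 0<B d≤B a-c<β) ⟩
      A ℚ.* α ℚ.+ B ℚ.* β
        ≡⟨ cong₂ ℚ._+_ Aα Bβ ⟩
      η ℚ.+ η ∎
      where open ℚ.≤-Reasoning

    *-cauchy : ∀ {x y} → Cauchy x → Cauchy y → Cauchy (λ n → x n ℚ.* y n)
    *-cauchy {x} {y} cx cy ε 0<ε =
      let A , 0<A , K , x≤A = bounded cx
          B , 0<B , L , y≤B = bounded cy
          α , 0<α , Aα = divide 0<A (half 0<ε)
          β , 0<β , Bβ = divide 0<B (half 0<ε)
          M , hx = cx β 0<β
          N , hy = cy α 0<α
      in (K ℕ.⊔ L) ℕ.⊔ (M ℕ.⊔ N) , λ m n m≥ n≥ →
        let K⊔L≤m = ℕ.m⊔n≤o⇒m≤o (K ℕ.⊔ L) (M ℕ.⊔ N) m≥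
            K⊔L≤n = ℕ.m⊔n≤o⇒m≤o (K ℕ.⊔ L) (M ℕ.⊔ N) n≥
            M⊔N≤m = ℕ.m⊔n≤o⇒n≤o (K ℕ.⊔ L) (M ℕ.⊔ N) m≥
            M⊔N≤n = ℕ.m⊔n≤o⇒n≤o (K ℕ.⊔ L) (M ℕ.⊔ N) n≥
        in subst (ℚ.∣ x m ℚ.* y m ℚ.- x n ℚ.* y n ∣ ℚ.<_) (half+half ε)
             (product-estimate (x m) (y m) (x n) (y n) 0<A 0<B Aα Bβ
               (x≤A m (ℕ.m⊔n≤o⇒m≤o K L K⊔L≤m))
               (y≤B n (ℕ.m⊔n≤o⇒n≤o K L K⊔L≤n))
               (hy m n (ℕ.m⊔n≤o⇒n≤o M N M⊔N≤m) (ℕ.m⊔n≤o⇒n≤o M N M⊔N≤n))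
               (hx m n (ℕ.m⊔n≤o⇒m≤o M N M⊔N≤m) (ℕ.m⊔n≤o⇒m≤o M N M⊔N≤n)))

infixl 6 _+_
infixl 7 _*_

_+_ : ℝ → ℝ → ℝ
x + y = record
  { seq    = λ n → seq x n ℚ.+ seq y n
  ; cauchy = +-cauchy {seq x} {seq y} (cauchy x) (cauchy y)
  }

_*_ : ℝ → ℝ → ℝ
x * y = record
  { seq    = λ n → seq x n ℚ.* seq y n
  ; cauchy = *-cauchy {seq x} {seq y} (cauchy x) (cauchy y)
  }

------------------------------------------------------------------------
-- Convexity and dimension in ℝᵐ

sumℝ : ∀ {k} → Vector ℝ k → ℝ
sumℝ = foldr _+_ 0ℝ

combination : ∀ {k m} → Vector ℝ k → Vector (Vector ℝ m) k → Vector ℝ m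
combination a p i = sumℝ (λ j → a j * p j i)

Conv : ∀ {m} → (Vector ℝ m → Set) → Vector ℝ m → Set
Conv {m} X x =
  ∃[ k ] Σ (Vector (Vector ℝ m) k) λ p → Σ (Vector ℝ k) λ a →
    (∀ j → X (p j)) × (∀ j → 0ℝ ≤ a j) × sumℝ a ≃ 1ℝ ×
    (∀ i → x i ≃ combination a p i)

AffinelyIndependent : ∀ {k m} → Vector (Vector ℝ m) k → Set
AffinelyIndependent {k} p = (a : Vector ℝ k) →
  sumℝ a ≃ 0ℝ → (∀ i → combination a p i ≃ 0ℝ) → ∀ j → a j ≃ 0ℝ

-- Affine dimension of a nonempty set: one less than the maximum size of
-- an affinely independent family of its points.
HasDimension : ∀ {m} → (Vector ℝ m → Set) → ℕ → Set
HasDimension {m} X d =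
  (Σ (Vector (Vector ℝ m) (suc d)) λ p → (∀ j → X (p j)) × AffinelyIndependent p) ×
  ((p : Vector (Vector ℝ m) (suc (suc d))) → (∀ j → X (p j)) → ¬ AffinelyIndependent p)

_·_ : ∀ {m} → Vector ℕ m → Vector ℝ m → ℝ
c · x = sumℝ (λ i → fromℕ (c i) * x i)

-- c x ≥ γ defines a facet of P: it is valid for P, and the face it
-- induces has dimension dim P − 1.
DefinesFacet : ∀ {m} → (Vector ℝ m → Set) → Vector ℕ m → ℕ → Set
DefinesFacet P c γ =
  (∀ x → P x → fromℕ γ ≤ c · x) ×
  ∃[ d ] HasDimension P (suc d) × HasDimension (λ x → P x × c · x ≃ fromℕ γ) d

------------------------------------------------------------------------
-- Graphs

-- V(G) = Fin n and E(G) = Fin m; an edge is stored with its endnodes in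
-- increasing order, so src<tgt excludes loops and simple excludes
-- multiple edges.
record Graph : Set where
  field
    n m     : ℕ
    src tgt : Fin m → Fin n
    src<tgt : ∀ e → src e Fin.< tgt e
    simple  : ∀ e e′ → src e ≡ src e′ → tgt e ≡ tgt e′ → e ≡ e′

  V E : Set
  V = Fin n
  E = Fin m

  Adjacent : V → V → Set
  Adjacent u v = ∃[ e ] ((src e ≡ u × tgt e ≡ v) ⊎ (src e ≡ v × tgt e ≡ u))

  -- Connectedness of the subgraph induced by a set of nodes.
  ConnectedOn : Subset n → Set
  ConnectedOn U = ∀ u v → u ∈ U → v ∈ U →
    Star (λ a b → a ∈ U × b ∈ U × Adjacent a b) u v

  Connected : Set
  Connected = ConnectedOn ⊤

  CutNode : V → Set
  CutNode w = ¬ ConnectedOn (∁ ⁅ w ⁆)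

  δ : Subset n → Subset m
  δ S = tabulate (λ e → lookup S (src e) xor lookup S (tgt e))

  -- In the absence of loops the edges incident with v form δ({v}).
  degree : V → ℕ
  degree v = ∣ δ ⁅ v ⁆ ∣

record SteinerGraph : Set where
  field
    graph : Graph

  open Graph graph public

  field
    connected : Connected
    T         : Subset n
    ∣T∣≥2     : 2 ℕ.≤ ∣ T ∣

record _≅_ (G H : SteinerGraph) : Set where
  private
    module G = SteinerGraph G
    module H = SteinerGraph H
  field
    bijection : G.V ↔ H.V

  open Inverse bijection using (to) public

  field
    adjacent : ∀ u v → G.Adjacent u v ⇔ H.Adjacent (to u) (to v)
    terminal : ∀ u → u ∈ G.T ⇔ to u ∈ H.T

------------------------------------------------------------------------
-- The Steiner cut dominant and its facets

χ : ∀ {m} → Subset m → Vector ℝ m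
χ F e = if lookup F e then 1ℝ else 0ℝ

weight : ∀ {m} → Vector ℕ m → Subset m → ℕ
weight c F = foldr ℕ._+_ 0 (λ e → if lookup F e then c e else 0)

MinimumIntegerForm : ∀ {m} → Vector ℕ m → Set
MinimumIntegerForm c = foldr gcd 0 c ≡ 1

module _ (G : SteinerGraph) where
  open SteinerGraph G

  SteinerCut : Subset m → Set
  SteinerCut F = ∃[ S ] (F ≡ δ S × Nonempty (T ∩ S) × Nonempty (T ─ S))

  CUT₊ : Vector ℝ m → Set
  CUT₊ x = Σ (Vector ℝ m) λ y → Σ (Vector ℝ m) λ r →
    Conv (λ p → ∃[ F ] (SteinerCut F × (∀ e → p e ≃ χ F e))) y ×
    (∀ e → 0ℝ ≤ r e) × (∀ e → x e ≃ y e + r e)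

  IsMinimumCutWeight : Vector ℕ m → ℕ → Set
  IsMinimumCutWeight c γ =
    (∃[ F ] (SteinerCut F × weight c F ≡ γ)) ×
    (∀ F → SteinerCut F → γ ℕ.≤ weight c F)

  FacetWeights : Vector ℕ m → Set
  FacetWeights c =
    MinimumIntegerForm c × (∀ e → 0 ℕ.< c e) ×
    ∃[ γ ] (IsMinimumCutWeight c γ × 0 ℕ.< γ × DefinesFacet CUT₊ c γ)

  FacetInducing : Set
  FacetInducing = ∃ FacetWeights

  Irreducible : Set
  Irreducible = (∀ w → ¬ CutNode w) × (∀ v → v ∉ T → degree v ≢ 2)

{-# OPTIONS --safe #-}

-- The incidence vectors of the minimum Steiner cuts span ℝᴱ, because the facet
-- has m linearly independent points and c > 0 forces its points to be
-- combinations of minimum cuts. Represent each minimum cut by the side S that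
-- avoids a fixed terminal r. Uncrossing two such sets yields a four-term
-- relation between minimum cuts, so the cuts of a maximal laminar family
-- already span. Every member of a laminar family of sets that meet T is
-- determined by a node or by a terminal, whence m ≤ n + τ. In an irreducible
-- graph all nonterminals have degree at least three, so 3 (n − τ) ≤ 2 m and
-- therefore n ≤ 5 τ.

module Submission where

open import Algebra.Bundles using (CommutativeRing)
open import Data.Bool.Base using (Bool; true; false; if_then_else_; _∧_; _∨_; _xor_; not)
open import Data.Bool.Properties using (xor-annihilates-not)
open import Data.Empty using (⊥; ⊥-elim)
open import Data.Fin.Base as Fin using (Fin; zero; suc; toℕ; fromℕ<; combine; inject≤; funToFin; finToFun; punchIn; remQuot)
import Data.Fin.Properties as Fin
open import Data.Fin.Subset hiding (⊥)
open import Data.Fin.Subset.Properties hiding (⊆-refl; ⊆-trans)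
open import Data.Integer.Base as ℤ using (+_)
import Data.Integer.Properties as ℤ
open import Data.List.Base as List using (List; []; _∷_; _++_; map; filter; length; allFin)
open import Data.List.Membership.Propositional using (find; lose) renaming (_∈_ to _∈ˡ_)
open import Data.List.Membership.Propositional.Properties using (∈-map⁺; ∈-++⁺ˡ; ∈-++⁺ʳ; ∈-allFin; ∈-filter⁺; ∈-filter⁻; ∈-lookup)
open import Data.List.Properties using (length-map; length-++; length-tabulate)
open import Data.List.Relation.Unary.All as All using (All; []; _∷_)
open import Data.List.Relation.Unary.AllPairs using (AllPairs; []; _∷_)
open import Data.List.Relation.Unary.Any as Any using (Any; here; there)
open import Data.Nat.Base as ℕ using (ℕ; zero; suc) renaming (_≤_ to _≤ℕ_)
import Data.Nat.Properties as ℕ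
open import Data.Nat.Tactic.RingSolver using (solve-∀)
open import Data.Product.Base using (Σ; ∃; ∃-syntax; _×_; _,_; proj₁; proj₂)
open import Data.Rational.Base as ℚ using (ℚ; 0ℚ; 1ℚ; ½)
import Data.Rational.Properties as ℚ
open import Data.Rational.Solver using (module +-*-Solver)
import Data.Rational.Unnormalised.Base as ℚᵘ
import Data.Rational.Unnormalised.Properties as ℚᵘ
open import Data.Sum.Base as Sum using (_⊎_; inj₁; inj₂)
open import Data.Vec.Base using (lookup; []; _∷_; here; there)
open import Data.Vec.Functional using (Vector; foldr; insertAt)
open import Data.Vec.Functional.Properties using (insertAt-punchIn; insertAt-lookup)
open import Data.Vec.Properties using (lookup-zipWith; lookup-map; lookup-replicate; lookup∘tabulate; tabulate-cong; []=⇒lookup; lookup⇒[]=)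
open import Function.Base using (_∘_; id; flip)
open import Function.Bundles using (_↔_; _⇔_; mk⇔; Inverse)
open import Function.Construct.Identity using (↔-id)
open import Level using (0ℓ)
open import Relation.Binary.Construct.Closure.ReflexiveTransitive using (Star; _◅_)
import Relation.Binary.PropositionalEquality as ≡
open import Relation.Binary.Structures using (IsEquivalence)
open import Relation.Nullary using (¬_; Dec; yes; no; does; contradiction; ¬?; decidable-stable; _×-dec_; _⊎-dec_; _→-dec_)
open import Relation.Nullary.Decidable using (map′; from-yes)
open import Relation.Unary using (Decidable)
open ≡ using (_≡_; _≢_)
import Algebra.Properties.Semiring.Sum ℕ.+-*-semiring as Σℕ

import Defs
open import Defs hiding (_+_; _*_; _≤_; _≃_)

-- Linear algebra over domains whose equality is ¬¬-stable

-- The bound `m ≤ n + τ` has to be this sharp. A laminar family on n nodes can have close to 2n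
-- members, and `3 (n − τ) ≤ 2 m` with m near 2n says nothing about n. The gain comes from the
-- terminals: a member without a node of its own splits into smaller members, each containing a
-- terminal, and can therefore be charged to a terminal that no other member uses.
--
-- Equality of Cauchy reals is undecidable, so neither a nonzero pivot nor a vanishing coefficient
-- can be searched for. What is to be proved, however, is either an equation between reals, which is
-- stable under double negation, or a comparison of natural numbers, which is decidable. The linear
-- algebra is therefore carried out without division, over an abstract domain with these properties,
-- and the distinction between minimum and other cuts is made on their natural-number weights.

record StableDomain : Set₁ where
  field
    commutativeRing : CommutativeRing 0ℓ 0ℓ

  open CommutativeRing commutativeRing public

  field
    ≈-stable    : ∀ {x y} → ¬ ¬ (x ≈ y) → x ≈ y
    *-cancel-≈0 : ∀ {x y} → ¬ (x ≈ 0#) → x * y ≈ 0# → y ≈ 0#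
    1≉0         : ¬ (1# ≈ 0#)

module LinearAlgebra (D : StableDomain) where

  open StableDomain D hiding (zero)
  open import Algebra.Properties.Semiring.Sum semiring public
  open import Algebra.Properties.Ring ring using (-‿distribˡ-*)
  open import Relation.Binary.Reasoning.Setoid setoid
  open import Algebra.Properties.CommutativeSemigroup +-commutativeSemigroup using (interchange)
  open import Algebra.Properties.CommutativeSemigroup *-commutativeSemigroup using (x∙yz≈y∙xz)

  -- Recursion on the generators exposes the coefficient of the head, the entry on which elimination
  -- pivots.
  Span : ∀ {m} → List (Vector Carrier m) → Vector Carrier m → Set
  Span []       v = ∀ i → v i ≈ 0#
  Span (g ∷ gs) v = ∃[ b ] ∃[ w ] (Span gs w × (∀ i → v i ≈ b * g i + w i))

  span-cong : ∀ {m} (gs : List (Vector Carrier m)) {v w} →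
              (∀ i → v i ≈ w i) → Span gs v → Span gs w
  span-cong []       v≈w v0            i = trans (sym (v≈w i)) (v0 i)
  span-cong (_ ∷ gs) v≈w (b , u , s , e) = b , u , s , λ i → trans (sym (v≈w i)) (e i)

  span-0 : ∀ {m} (gs : List (Vector Carrier m)) → Span gs (λ _ → 0#)
  span-0 []       i = refl
  span-0 (g ∷ gs) = 0# , (λ _ → 0#) , span-0 gs , λ i →
    sym (trans (+-identityʳ _) (zeroˡ (g i)))

  span-+ : ∀ {m} (gs : List (Vector Carrier m)) {v w} →
           Span gs v → Span gs w → Span gs (λ i → v i + w i)
  span-+ []       v0 w0 i = trans (+-cong (v0 i) (w0 i)) (+-identityʳ 0#)
  span-+ (g ∷ gs) (b , v , s , e) (d , w , t , f) =
    b + d , (λ i → v i + w i) , span-+ gs s t , λ i →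
      trans (+-cong (e i) (f i))
        (trans (interchange _ _ _ _) (+-congʳ (sym (distribʳ (g i) b d))))

  span-* : ∀ {m} (gs : List (Vector Carrier m)) a {v} → Span gs v → Span gs (λ i → a * v i)
  span-* []       a v0 i = trans (*-congˡ (v0 i)) (zeroʳ a)
  span-* (g ∷ gs) a (b , w , s , e) = a * b , (λ i → a * w i) , span-* gs a s , λ i →
    trans (*-congˡ (e i)) (trans (distribˡ a _ _) (+-congʳ (sym (*-assoc a b (g i)))))

  span-∈ : ∀ {m} {gs : List (Vector Carrier m)} {v} → v ∈ˡ gs → Span gs v
  span-∈ {gs = g ∷ gs} (here ≡.refl) = 1# , (λ _ → 0#) , span-0 gs , λ i →
    sym (trans (+-identityʳ _) (*-identityˡ (g i)))
  span-∈ {gs = g ∷ gs} {v} (there v∈) = 0# , v , span-∈ v∈ , λ i →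
    sym (trans (+-congʳ (zeroˡ (g i))) (+-identityˡ (v i)))

  -- Meant for uncrossing, where `u` and `v` are the incidence vectors of the two crossing cuts and
  -- `w` and `x` those of the two new ones.
  span-solve : ∀ {m} (gs : List (Vector Carrier m)) {u v w x} →
               (∀ i → u i + v i ≈ w i + x i) →
               Span gs v → Span gs w → Span gs x → Span gs u
  span-solve gs {u} {v} {w} {x} e sv sw sx = span-cong gs difference
    (span-+ gs (span-+ gs sw sx) (span-* gs (- 1#) sv))
    where
    difference : ∀ i → w i + x i + - 1# * v i ≈ u i
    difference i = begin
      w i + x i + - 1# * v i  ≈⟨ +-cong (e i) (-‿distribˡ-* 1# (v i)) ⟨
      u i + v i + - (1# * v i) ≈⟨ +-congˡ (-‿cong (*-identityˡ (v i))) ⟩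
      u i + v i + - v i       ≈⟨ +-assoc (u i) (v i) (- v i) ⟩
      u i + (v i + - v i)     ≈⟨ +-congˡ (-‿inverseʳ (v i)) ⟩
      u i + 0#                ≈⟨ +-identityʳ (u i) ⟩
      u i                     ∎

  -- The second alternative admits points outside the span: a point of the face may be given as a
  -- combination that lists cuts of larger weight, of which only the coefficients are known to
  -- vanish.
  span-sum : ∀ {m k} (gs : List (Vector Carrier m)) (a : Vector Carrier k)
             (p : Vector (Vector Carrier m) k) →
             (∀ j → Span gs (p j) ⊎ a j ≈ 0#) → Span gs (λ i → sum (λ j → a j * p j i))
  span-sum {k = zero}  gs a p s = span-0 gs
  span-sum {k = suc k} gs a p s =
    span-+ gs (head (s zero)) (span-sum gs (λ j → a (suc j)) (λ j → p (suc j)) (λ j → s (suc j)))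
    where
    head : Span gs (p zero) ⊎ a zero ≈ 0# → Span gs (λ i → a zero * p zero i)
    head (inj₁ sp)  = span-* gs (a zero) sp
    head (inj₂ a≈0) = span-cong gs (λ i → sym (trans (*-congʳ a≈0) (zeroˡ _))) (span-0 gs)

  LinearlyIndependent : ∀ {m k} → Vector (Vector Carrier m) k → Set
  LinearlyIndependent {k = k} x = (a : Vector Carrier k) →
    (∀ i → sum (λ j → a j * x j i) ≈ 0#) → ∀ j → a j ≈ 0#

  -- Fraction-free elimination: the pivot is only known not to be zero, which
  -- gives no inverse.
  independent⇒≤ : ∀ {m} (gs : List (Vector Carrier m)) {k} (x : Vector (Vector Carrier m) k) →
                  (∀ j → Span gs (x j)) → LinearlyIndependent x → k ℕ.≤ length gs
  independent⇒≤ gs {zero} x s ind = ℕ.z≤n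
  independent⇒≤ [] {suc k} x s ind = contradiction (ind (λ _ → 1#) vanishes zero) 1≉0
    where
    vanishes : ∀ i → sum (λ j → 1# * x j i) ≈ 0#
    vanishes i = trans (sum-cong-≋ (λ j → trans (*-identityˡ _) (s j i))) (sum-replicate-zero (suc k))
  -- Whether some head coefficient is nonzero cannot be decided, but the inequality can, so it may
  -- be refuted. Its negation excludes every pivot, which by stability makes all head coefficients
  -- zero.
  independent⇒≤ (g ∷ gs) {suc k} x s ind = decidable-stable (suc k ℕ.≤? suc (length gs)) λ ≰ →
    ≰ (no-pivot λ j → ≈-stable λ b≉0 → ≰ (pivot j b≉0))
    where
    b = λ j → proj₁ (s j)
    y = λ j → proj₁ (proj₂ (s j))

    no-pivot : (∀ j → b j ≈ 0#) → suc k ℕ.≤ suc (length gs)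
    no-pivot b≈0 = ℕ.m≤n⇒m≤1+n (independent⇒≤ gs x
      (λ j → span-cong gs (λ i → sym (trans (proj₂ (proj₂ (proj₂ (s j))) i)
        (trans (+-congʳ (trans (*-congʳ (b≈0 j)) (zeroˡ (g i)))) (+-identityˡ _))))
        (proj₁ (proj₂ (proj₂ (s j))))) ind)

    pivot : ∀ p → ¬ (b p ≈ 0#) → suc k ℕ.≤ suc (length gs)
    pivot p bp≉0 = ℕ.s≤s (independent⇒≤ gs x′ s′ ind′)
      where
      q = punchIn p
      x′ : Vector (Vector Carrier _) k
      x′ j i = b p * x (q j) i + - b (q j) * x p i

      s′ : ∀ j → Span gs (x′ j)
      s′ j = span-cong gs eliminate
        (span-+ gs (span-* gs (b p) (proj₁ (proj₂ (proj₂ (s (q j))))))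
                   (span-* gs (- b (q j)) (proj₁ (proj₂ (proj₂ (s p))))))
        where
        eliminate : ∀ i → b p * y (q j) i + - b (q j) * y p i ≈ x′ j i
        eliminate i = sym (begin
          b p * x (q j) i + - b (q j) * x p i
            ≈⟨ +-cong (*-congˡ (proj₂ (proj₂ (proj₂ (s (q j)))) i))
                      (*-congˡ (proj₂ (proj₂ (proj₂ (s p))) i)) ⟩
          b p * (b (q j) * g i + y (q j) i) + - b (q j) * (b p * g i + y p i)
            ≈⟨ +-cong (distribˡ _ _ _) (distribˡ _ _ _) ⟩
          (b p * (b (q j) * g i) + b p * y (q j) i) + (- b (q j) * (b p * g i) + - b (q j) * y p i)
            ≈⟨ interchange _ _ _ _ ⟩
          (b p * (b (q j) * g i) + - b (q j) * (b p * g i)) + (b p * y (q j) i + - b (q j) * y p i)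
            ≈⟨ +-congʳ cancels ⟩
          0# + (b p * y (q j) i + - b (q j) * y p i)
            ≈⟨ +-identityˡ _ ⟩
          b p * y (q j) i + - b (q j) * y p i ∎)
          where
          cancels : b p * (b (q j) * g i) + - b (q j) * (b p * g i) ≈ 0#
          cancels = begin
            b p * (b (q j) * g i) + - b (q j) * (b p * g i)
              ≈⟨ +-cong (x∙yz≈y∙xz _ _ _) (sym (-‿distribˡ-* _ _)) ⟩
            b (q j) * (b p * g i) + - (b (q j) * (b p * g i))
              ≈⟨ -‿inverseʳ _ ⟩
            0# ∎

      ind′ : LinearlyIndependent x′
      ind′ a Σ≈0 j = *-cancel-≈0 bp≉0 (trans (*-comm _ _)
        (trans (reflexive (≡.sym (insertAt-punchIn low p top j))) (ind a⁺ vanishes (q j))))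
        where
        -- A relation `a` among the `x′ j`, expanded in terms of `x`: `low` holds the coefficients
        -- of the vectors other than the pivot, `top` collects that of the pivot.
        low : Vector Carrier k
        low j = a j * b p
        top : Carrier
        top = sum (λ j → a j * - b (q j))
        a⁺ : Vector Carrier (suc k)
        a⁺ = insertAt low p top
        vanishes : ∀ i → sum (λ l → a⁺ l * x l i) ≈ 0#
        vanishes i = begin
          sum (λ l → a⁺ l * x l i)
            ≈⟨ sum-remove {i = p} (λ l → a⁺ l * x l i) ⟩
          a⁺ p * x p i + sum (λ j → a⁺ (q j) * x (q j) i)
            ≈⟨ +-cong (*-congʳ (reflexive (insertAt-lookup low p top)))
                 (sum-cong-≋ {k} {λ j → a⁺ (q j) * x (q j) i} λ j →
                   *-congʳ (reflexive (insertAt-punchIn low p top j))) ⟩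
          top * x p i + sum (λ j → low j * x (q j) i)
            ≈⟨ +-congʳ (*-distribʳ-sum (x p i) (λ j → a j * - b (q j))) ⟩
          sum (λ j → a j * - b (q j) * x p i) + sum (λ j → low j * x (q j) i)
            ≈⟨ ∑-distrib-+ (λ j → a j * - b (q j) * x p i) (λ j → low j * x (q j) i) ⟨
          sum (λ j → a j * - b (q j) * x p i + low j * x (q j) i)
            ≈⟨ sum-cong-≋ collect ⟩
          sum (λ j → a j * x′ j i)
            ≈⟨ Σ≈0 i ⟩
          0# ∎
          where
          collect : ∀ j → a j * - b (q j) * x p i + low j * x (q j) i ≈ a j * x′ j i
          collect j = trans (+-cong (*-assoc (a j) (- b (q j)) (x p i)) (*-assoc (a j) (b p) (x (q j) i)))
            (trans (+-comm _ _) (sym (distribˡ (a j) _ _)))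

-- Ordered domains: points of a face and affine independence

record OrderedDomain : Set₁ where
  infix 4 0≤_
  field
    domain : StableDomain

  open StableDomain domain public

  field
    0≤_        : Carrier → Set
    0≤-resp-≈  : ∀ {x y} → x ≈ y → 0≤ x → 0≤ y
    0≤-+       : ∀ {x y} → 0≤ x → 0≤ y → 0≤ (x + y)
    +-tight    : ∀ {x y} → 0≤ x → 0≤ y → x + y ≈ 0# → x ≈ 0#
    ⌜_⌝        : ℕ → Carrier
    0≤⌜⌝       : ∀ k → 0≤ ⌜ k ⌝
    ⌜0⌝        : ⌜ 0 ⌝ ≈ 0#
    ⌜1⌝        : ⌜ 1 ⌝ ≈ 1#
    ⌜suc⌝      : ∀ k → ⌜ suc k ⌝ ≈ 1# + ⌜ k ⌝

module OrderedAlgebra (O : OrderedDomain) where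

  open OrderedDomain O hiding (zero)
  open LinearAlgebra domain
  open import Relation.Binary.Reasoning.Setoid setoid
  open import Algebra.Properties.Group +-group using () renaming (∙-cancelˡ to +-cancelˡ)
  open import Algebra.Properties.CommutativeSemigroup *-commutativeSemigroup using (x∙yz≈y∙xz)

  ⌜+⌝ : ∀ k l → ⌜ k ℕ.+ l ⌝ ≈ ⌜ k ⌝ + ⌜ l ⌝
  ⌜+⌝ zero    l = sym (trans (+-congʳ ⌜0⌝) (+-identityˡ ⌜ l ⌝))
  ⌜+⌝ (suc k) l = begin
    ⌜ suc (k ℕ.+ l) ⌝        ≈⟨ ⌜suc⌝ (k ℕ.+ l) ⟩
    1# + ⌜ k ℕ.+ l ⌝         ≈⟨ +-congˡ (⌜+⌝ k l) ⟩
    1# + (⌜ k ⌝ + ⌜ l ⌝)     ≈⟨ +-assoc 1# ⌜ k ⌝ ⌜ l ⌝ ⟨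
    1# + ⌜ k ⌝ + ⌜ l ⌝       ≈⟨ +-congʳ (⌜suc⌝ k) ⟨
    ⌜ suc k ⌝ + ⌜ l ⌝        ∎

  0≤1 : 0≤ 1#
  0≤1 = 0≤-resp-≈ ⌜1⌝ (0≤⌜⌝ 1)

  ⌜⌝≉0 : ∀ {k} → 0 ℕ.< k → ¬ (⌜ k ⌝ ≈ 0#)
  ⌜⌝≉0 {suc k} _ ⌜1+k⌝≈0 = 1≉0 (+-tight 0≤1 (0≤⌜⌝ k) (trans (sym (⌜suc⌝ k)) ⌜1+k⌝≈0))

  0≤⌜⌝* : ∀ k {x} → 0≤ x → 0≤ (⌜ k ⌝ * x)
  0≤⌜⌝* zero {x} _ = 0≤-resp-≈ (trans ⌜0⌝ (sym (trans (*-congʳ ⌜0⌝) (zeroˡ x)))) (0≤⌜⌝ 0)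
  0≤⌜⌝* (suc k) {x} 0≤x = 0≤-resp-≈ (begin
    x + ⌜ k ⌝ * x          ≈⟨ +-congʳ (*-identityˡ x) ⟨
    1# * x + ⌜ k ⌝ * x     ≈⟨ distribʳ x 1# ⌜ k ⌝ ⟨
    (1# + ⌜ k ⌝) * x       ≈⟨ *-congʳ (⌜suc⌝ k) ⟨
    ⌜ suc k ⌝ * x          ∎) (0≤-+ 0≤x (0≤⌜⌝* k 0≤x))

  0≤-sum : ∀ {k} {t : Vector Carrier k} → (∀ j → 0≤ t j) → 0≤ sum t
  0≤-sum {zero}  _   = 0≤-resp-≈ ⌜0⌝ (0≤⌜⌝ 0)
  0≤-sum {suc k} 0≤t = 0≤-+ (0≤t zero) (0≤-sum (λ j → 0≤t (suc j)))

  +-tightʳ : ∀ {x y} → 0≤ x → 0≤ y → x + y ≈ 0# → y ≈ 0#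
  +-tightʳ 0≤x 0≤y x+y≈0 = +-tight 0≤y 0≤x (trans (+-comm _ _) x+y≈0)

  sum-tight-zero : ∀ {k} {t : Vector Carrier k} → (∀ j → 0≤ t j) → sum t ≈ 0# → ∀ j → t j ≈ 0#
  sum-tight-zero 0≤t Σt≈0 zero    = +-tight (0≤t zero) (0≤-sum (λ j → 0≤t (suc j))) Σt≈0
  sum-tight-zero 0≤t Σt≈0 (suc j) = sum-tight-zero (λ j → 0≤t (suc j))
    (+-tightʳ (0≤t zero) (0≤-sum (λ j → 0≤t (suc j))) Σt≈0) j

  sum-zero : ∀ {k} {t : Vector Carrier k} → (∀ j → t j ≈ 0#) → sum t ≈ 0#
  sum-zero {k} t≈0 = trans (sum-cong-≋ t≈0) (sum-replicate-zero k)

  sum-single : ∀ {k} (t : Vector Carrier k) l → (∀ j → j ≢ l → t j ≈ 0#) → sum t ≈ t l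
  sum-single {suc k} t l t≈0 = trans (sum-remove {i = l} t)
    (trans (+-congˡ (sum-zero (λ j → t≈0 (punchIn l j) (Fin.punchInᵢ≢i l j)))) (+-identityʳ (t l)))

  dot : ∀ {m} → Vector ℕ m → Vector Carrier m → Carrier
  dot c x = sum (λ i → ⌜ c i ⌝ * x i)

  dot-cong : ∀ {m} (c : Vector ℕ m) {x y} → (∀ i → x i ≈ y i) → dot c x ≈ dot c y
  dot-cong c x≈y = sum-cong-≋ λ i → *-congˡ (x≈y i)

  dot-+ : ∀ {m} (c : Vector ℕ m) x y → dot c (λ i → x i + y i) ≈ dot c x + dot c y
  dot-+ c x y = trans (sum-cong-≋ λ i → distribˡ ⌜ c i ⌝ (x i) (y i))
    (∑-distrib-+ (λ i → ⌜ c i ⌝ * x i) (λ i → ⌜ c i ⌝ * y i))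

  dot-combination : ∀ {m k} (c : Vector ℕ m) (a : Vector Carrier k) (p : Vector (Vector Carrier m) k) →
                    dot c (λ i → sum (λ j → a j * p j i)) ≈ sum (λ j → a j * dot c (p j))
  dot-combination c a p = begin
    sum (λ i → ⌜ c i ⌝ * sum (λ j → a j * p j i))
      ≈⟨ sum-cong-≋ (λ i → *-distribˡ-sum ⌜ c i ⌝ (λ j → a j * p j i)) ⟩
    sum (λ i → sum (λ j → ⌜ c i ⌝ * (a j * p j i)))
      ≈⟨ ∑-comm (λ i j → ⌜ c i ⌝ * (a j * p j i)) ⟩
    sum (λ j → sum (λ i → ⌜ c i ⌝ * (a j * p j i)))
      ≈⟨ sum-cong-≋ (λ j → sum-cong-≋ (λ i → x∙yz≈y∙xz ⌜ c i ⌝ (a j) (p j i))) ⟩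
    sum (λ j → sum (λ i → a j * (⌜ c i ⌝ * p j i)))
      ≈⟨ sum-cong-≋ (λ j → *-distribˡ-sum (a j) (λ i → ⌜ c i ⌝ * p j i)) ⟨
    sum (λ j → a j * dot c (p j)) ∎

  -- The value `c x` equals `γ` plus the weighted excesses `w j − γ` plus `c r`. The last two are
  -- sums of nonnegative terms, so `c x ≈ γ` makes every term vanish. Positive weights then give
  -- `r ≈ 0`, and a positive excess forces `a j ≈ 0`.
  face-point : ∀ {m k} (c : Vector ℕ m) (γ : ℕ) (w : Vector ℕ k)
    (a : Vector Carrier k) (p : Vector (Vector Carrier m) k) (r x : Vector Carrier m) →
    (∀ i → 0 ℕ.< c i) → (∀ j → γ ℕ.≤ w j) → (∀ j → dot c (p j) ≈ ⌜ w j ⌝) →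
    (∀ j → 0≤ a j) → sum a ≈ 1# → (∀ i → 0≤ r i) →
    (∀ i → x i ≈ sum (λ j → a j * p j i) + r i) → dot c x ≈ ⌜ γ ⌝ →
    (∀ j → w j ≡ γ ⊎ a j ≈ 0#) × (∀ i → r i ≈ 0#)
  face-point c γ w a p r x c>0 γ≤w dot-p 0≤a Σa≈1 0≤r x≈ dot-x = support , λ i →
    *-cancel-≈0 (⌜⌝≉0 (c>0 i))
      (sum-tight-zero (λ i → 0≤⌜⌝* (c i) (0≤r i)) (+-tightʳ 0≤excess 0≤dot-r excess≈0) i)
    where
    s = λ j → w j ℕ.∸ γ

    0≤sa : ∀ j → 0≤ (⌜ s j ⌝ * a j)
    0≤sa j = 0≤⌜⌝* (s j) (0≤a j)

    excess = sum (λ j → ⌜ s j ⌝ * a j)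

    0≤excess : 0≤ excess
    0≤excess = 0≤-sum 0≤sa

    0≤dot-r : 0≤ dot c r
    0≤dot-r = 0≤-sum λ i → 0≤⌜⌝* (c i) (0≤r i)

    value : ∀ j → a j * dot c (p j) ≈ a j * ⌜ γ ⌝ + ⌜ s j ⌝ * a j
    value j = begin
      a j * dot c (p j)               ≈⟨ *-congˡ (dot-p j) ⟩
      a j * ⌜ w j ⌝                   ≡⟨ ≡.cong (λ l → a j * ⌜ l ⌝) (ℕ.m+[n∸m]≡n (γ≤w j)) ⟨
      a j * ⌜ γ ℕ.+ s j ⌝             ≈⟨ *-congˡ (⌜+⌝ γ (s j)) ⟩
      a j * (⌜ γ ⌝ + ⌜ s j ⌝)         ≈⟨ distribˡ (a j) ⌜ γ ⌝ ⌜ s j ⌝ ⟩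
      a j * ⌜ γ ⌝ + a j * ⌜ s j ⌝     ≈⟨ +-congˡ (*-comm (a j) ⌜ s j ⌝) ⟩
      a j * ⌜ γ ⌝ + ⌜ s j ⌝ * a j     ∎

    dot-split : dot c x ≈ ⌜ γ ⌝ + (excess + dot c r)
    dot-split = begin
      dot c x
        ≈⟨ dot-cong c x≈ ⟩
      dot c (λ i → sum (λ j → a j * p j i) + r i)
        ≈⟨ dot-+ c (λ i → sum (λ j → a j * p j i)) r ⟩
      dot c (λ i → sum (λ j → a j * p j i)) + dot c r
        ≈⟨ +-congʳ (dot-combination c a p) ⟩
      sum (λ j → a j * dot c (p j)) + dot c r
        ≈⟨ +-congʳ (sum-cong-≋ value) ⟩
      sum (λ j → a j * ⌜ γ ⌝ + ⌜ s j ⌝ * a j) + dot c r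
        ≈⟨ +-congʳ (∑-distrib-+ (λ j → a j * ⌜ γ ⌝) (λ j → ⌜ s j ⌝ * a j)) ⟩
      sum (λ j → a j * ⌜ γ ⌝) + excess + dot c r
        ≈⟨ +-congʳ (+-congʳ (*-distribʳ-sum ⌜ γ ⌝ a)) ⟨
      sum a * ⌜ γ ⌝ + excess + dot c r
        ≈⟨ +-congʳ (+-congʳ (trans (*-congʳ Σa≈1) (*-identityˡ ⌜ γ ⌝))) ⟩
      ⌜ γ ⌝ + excess + dot c r
        ≈⟨ +-assoc ⌜ γ ⌝ excess (dot c r) ⟩
      ⌜ γ ⌝ + (excess + dot c r) ∎

    excess≈0 : excess + dot c r ≈ 0#
    excess≈0 = +-cancelˡ ⌜ γ ⌝ _ _ (trans (sym dot-split) (trans dot-x (sym (+-identityʳ ⌜ γ ⌝))))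

    support : ∀ j → w j ≡ γ ⊎ a j ≈ 0#
    support j with w j ℕ.≟ γ
    ... | yes w≡γ = inj₁ w≡γ
    ... | no  w≢γ = inj₂ (*-cancel-≈0 (⌜⌝≉0 (ℕ.m<n⇒0<n∸m (ℕ.≤∧≢⇒< (γ≤w j) (≡.≢-sym w≢γ))))
      (sum-tight-zero 0≤sa (+-tight 0≤excess 0≤dot-r excess≈0) j))

  AffineIndependent : ∀ {m k} → Vector (Vector Carrier m) k → Set
  AffineIndependent {k = k} x = (a : Vector Carrier k) →
    sum a ≈ 0# → (∀ i → sum (λ j → a j * x j i) ≈ 0#) → ∀ j → a j ≈ 0#

  -- An affine hyperplane c x = γ with γ ≠ 0 misses the origin.
  affine⇒linear : ∀ {m k} (c : Vector ℕ m) {γ} (x : Vector (Vector Carrier m) k) →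
    0 ℕ.< γ → (∀ j → dot c (x j) ≈ ⌜ γ ⌝) → AffineIndependent x → LinearlyIndependent x
  affine⇒linear c {γ} x 0<γ dot-x ind a Σ≈0 = ind a (*-cancel-≈0 (⌜⌝≉0 0<γ) (begin
    ⌜ γ ⌝ * sum a                             ≈⟨ *-comm ⌜ γ ⌝ (sum a) ⟩
    sum a * ⌜ γ ⌝                             ≈⟨ *-distribʳ-sum ⌜ γ ⌝ a ⟩
    sum (λ j → a j * ⌜ γ ⌝)                   ≈⟨ sum-cong-≋ (λ j → *-congˡ (dot-x j)) ⟨
    sum (λ j → a j * dot c (x j))             ≈⟨ dot-combination c a x ⟨
    dot c (λ i → sum (λ j → a j * x j i))     ≈⟨ sum-zero (λ i → trans (*-congˡ (Σ≈0 i)) (zeroʳ ⌜ c i ⌝)) ⟩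
    0#                                        ∎)) Σ≈0

  corner : ∀ {m k} → Vector (Vector Carrier m) k → Vector (Vector Carrier m) (suc k)
  corner u zero    i = 0#
  corner u (suc j) i = u j i

  -- As the coefficients sum to zero, the base point `y` drops out; coordinate `ι l` then isolates
  -- the coefficient of `y + u l`, and the coefficient of `y` vanishes with the sum.
  corner-independent : ∀ {m k} (y : Vector Carrier m) (u : Vector (Vector Carrier m) k)
    (ι : Fin k → Fin m) →
    (∀ j → u j (ι j) ≈ 1#) → (∀ j l → j ≢ l → u j (ι l) ≈ 0#) →
    AffineIndependent (λ j i → y i + corner u j i)
  corner-independent {m} {k} y u ι diag off a Σa≈0 Σ≈0 = vanish
    where
    shift : ∀ i → sum (λ j → a j * corner u j i) ≈ 0#
    shift i = begin
      sum (λ j → a j * corner u j i)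
        ≈⟨ +-identityˡ _ ⟨
      0# + sum (λ j → a j * corner u j i)
        ≈⟨ +-congʳ (trans (*-congʳ Σa≈0) (zeroˡ (y i))) ⟨
      sum a * y i + sum (λ j → a j * corner u j i)
        ≈⟨ +-congʳ (*-distribʳ-sum (y i) a) ⟩
      sum (λ j → a j * y i) + sum (λ j → a j * corner u j i)
        ≈⟨ ∑-distrib-+ (λ j → a j * y i) (λ j → a j * corner u j i) ⟨
      sum (λ j → a j * y i + a j * corner u j i)
        ≈⟨ sum-cong-≋ (λ j → distribˡ (a j) (y i) (corner u j i)) ⟨
      sum (λ j → a j * (y i + corner u j i))
        ≈⟨ Σ≈0 i ⟩
      0# ∎

    a-suc : ∀ l → a (suc l) ≈ 0#
    a-suc l = begin
      a (suc l)
        ≈⟨ *-identityʳ (a (suc l)) ⟨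
      a (suc l) * 1#
        ≈⟨ *-congˡ (diag l) ⟨
      a (suc l) * u l (ι l)
        ≈⟨ sum-single (λ j → a (suc j) * u j (ι l)) l
             (λ j j≢l → trans (*-congˡ (off j l j≢l)) (zeroʳ (a (suc j)))) ⟨
      sum (λ j → a (suc j) * u j (ι l))
        ≈⟨ +-identityˡ _ ⟨
      0# + sum (λ j → a (suc j) * u j (ι l))
        ≈⟨ +-congʳ (zeroʳ (a zero)) ⟨
      a zero * 0# + sum (λ j → a (suc j) * u j (ι l))
        ≈⟨ shift (ι l) ⟩
      0# ∎

    vanish : ∀ j → a j ≈ 0#
    vanish (suc l) = a-suc l
    vanish zero    = begin
      a zero                               ≈⟨ +-identityʳ (a zero) ⟨
      a zero + 0#                          ≈⟨ +-congˡ (sum-zero a-suc) ⟨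
      a zero + sum (λ l → a (suc l))       ≈⟨ Σa≈0 ⟩
      0#                                   ∎

open ≡ using (refl; sym; trans; cong; cong₂; subst; subst₂; ≢-sym; module ≡-Reasoning)

-- Laminar families

x∈p─q⇒x∉q : ∀ {n} {x : Fin n} p q → x ∈ p ─ q → x ∉ q
x∈p─q⇒x∉q (true  ∷ p) (false ∷ q) here ()
x∈p─q⇒x∉q (_ ∷ p)     (_ ∷ q)     (there x∈) (there x∈q) = x∈p─q⇒x∉q p q x∈ x∈q

allSubsets : ∀ n → List (Subset n)
allSubsets zero    = [] ∷ []
allSubsets (suc n) = map (inside ∷_) (allSubsets n) ++ map (outside ∷_) (allSubsets n)

∈-allSubsets : ∀ {n} (S : Subset n) → S ∈ˡ allSubsets n
∈-allSubsets []          = here refl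
∈-allSubsets (true  ∷ S) = ∈-++⁺ˡ (∈-map⁺ (inside ∷_) (∈-allSubsets S))
∈-allSubsets (false ∷ S) = ∈-++⁺ʳ _ (∈-map⁺ (outside ∷_) (∈-allSubsets S))

elements : ∀ {n} → Subset n → List (Fin n)
elements []          = []
elements (true  ∷ S) = zero ∷ map suc (elements S)
elements (false ∷ S) = map suc (elements S)

∈-elements : ∀ {n} {S : Subset n} {v} → v ∈ S → v ∈ˡ elements S
∈-elements {S = true  ∷ S} here       = here refl
∈-elements {S = true  ∷ S} (there v∈) = there (∈-map⁺ suc (∈-elements v∈))
∈-elements {S = false ∷ S} (there v∈) = ∈-map⁺ suc (∈-elements v∈)

length-elements : ∀ {n} (S : Subset n) → length (elements S) ≡ ∣ S ∣
length-elements []          = refl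
length-elements (true  ∷ S) = cong suc (trans (length-map suc (elements S)) (length-elements S))
length-elements (false ∷ S) = trans (length-map suc (elements S)) (length-elements S)

module _ {n : ℕ} where

  -- `Cross` is the relation usually called intersecting; in a family without it any two members are
  -- disjoint or nested.
  Meets Exceeds Cross : Subset n → Subset n → Set
  Meets   X Y = ∃[ v ] (v ∈ X × v ∈ Y)
  Exceeds X Y = ∃[ v ] (v ∈ X × v ∉ Y)
  Cross   X Y = Meets X Y × Exceeds X Y × Exceeds Y X

  exceeds? : ∀ X Y → Dec (Exceeds X Y)
  exceeds? X Y = Fin.any? λ v → v ∈? X ×-dec ¬? (v ∈? Y)

  cross? : ∀ X Y → Dec (Cross X Y)
  cross? X Y = Fin.any? (λ v → v ∈? X ×-dec v ∈? Y) ×-dec exceeds? X Y ×-dec exceeds? Y X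

  cross-sym : ∀ {X Y} → Cross X Y → Cross Y X
  cross-sym ((v , v∈X , v∈Y) , X\Y , Y\X) = (v , v∈Y , v∈X) , Y\X , X\Y

  ¬exceeds⇒⊆ : ∀ {X Y} → ¬ Exceeds X Y → X ⊆ Y
  ¬exceeds⇒⊆ {X} {Y} ¬X\Y {v} v∈X with v ∈? Y
  ... | yes v∈Y = v∈Y
  ... | no  v∉Y = contradiction (v , v∈X , v∉Y) ¬X\Y

  nested : ∀ {X Y} → ¬ Cross X Y → Meets X Y → X ⊆ Y ⊎ Y ⊆ X
  nested {X} {Y} ¬XY m with exceeds? X Y | exceeds? Y X
  ... | no ¬X\Y | _        = inj₁ (¬exceeds⇒⊆ ¬X\Y)
  ... | yes _   | no ¬Y\X  = inj₂ (¬exceeds⇒⊆ ¬Y\X)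
  ... | yes X\Y | yes Y\X  = contradiction (m , X\Y , Y\X) ¬XY

  ∈-∪ : ∀ {X Y : Subset n} {v} → v ∈ X ∪ Y → v ∉ X → v ∈ Y
  ∈-∪ {X} {Y} v∈ v∉X with x∈p∪q⁻ X Y v∈
  ... | inj₁ v∈X = contradiction v∈X v∉X
  ... | inj₂ v∈Y = v∈Y

  ¬cross-∩ : ∀ S X → ¬ Cross X (S ∩ X)
  ¬cross-∩ S X (_ , _ , v , v∈ , v∉X) = v∉X (proj₂ (x∈p∩q⁻ S X v∈))

  ¬cross-∪ : ∀ S X → ¬ Cross X (S ∪ X)
  ¬cross-∪ S X (_ , (v , v∈X , v∉) , _) = v∉ (x∈p∪q⁺ {p = S} (inj₂ v∈X))

  ¬cross-─ˡ : ∀ S X → ¬ Cross X (S ─ X)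
  ¬cross-─ˡ S X ((v , v∈X , v∈) , _) = x∈p─q⇒x∉q S X v∈ v∈X

  ¬cross-─ʳ : ∀ S X → ¬ Cross X (X ─ S)
  ¬cross-─ʳ S X (_ , _ , v , v∈ , v∉X) = v∉X (p─q⊆p X S v∈)

  -- Uncrossing a set with a member X of a laminar family creates no new
  -- crossing with a member Y.
  module _ {S X Y : Subset n} (¬YX : ¬ Cross Y X) (XS : Cross X S) where

    cross-∩ : Cross Y (S ∩ X) → Cross Y S
    cross-∩ ((u , u∈Y , u∈) , (v , v∈Y , v∉) , (w , w∈ , w∉Y)) =
      let u∈S , u∈X = x∈p∩q⁻ S X u∈
          w∈S , w∈X = x∈p∩q⁻ S X w∈
      in (u , u∈Y , u∈S)
       , (v , v∈Y , λ v∈S → ¬YX ((u , u∈Y , u∈X)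
                               , (v , v∈Y , λ v∈X → v∉ (x∈p∩q⁺ (v∈S , v∈X)))
                               , (w , w∈X , w∉Y)))
       , (w , w∈S , w∉Y)

    cross-∪ : Cross Y (S ∪ X) → Cross Y S
    cross-∪ ((u , u∈Y , u∈) , (v , v∈Y , v∉) , (w , w∈ , w∉Y)) =
      meets , (v , v∈Y , v∉S) , exceeds
      where
      v∉S : v ∉ S
      v∉S v∈S = v∉ (x∈p∪q⁺ (inj₁ v∈S))
      v∉X : v ∉ X
      v∉X v∈X = v∉ (x∈p∪q⁺ {p = S} (inj₂ v∈X))
      -- One node common to `X` and `S` serves both remaining claims: inside `Y` it shows that `Y`
      -- meets `S`, outside `Y` that `S` exceeds `Y`. Where it does not help, `Y` would cross `X`.
      a = proj₁ (proj₁ XS)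
      a∈X = proj₁ (proj₂ (proj₁ XS))
      a∈S = proj₂ (proj₂ (proj₁ XS))
      meets : Meets Y S
      meets with u ∈? S | a ∈? Y
      ... | yes u∈S | _ = u , u∈Y , u∈S
      ... | no _    | yes a∈Y = a , a∈Y , a∈S
      ... | no u∉S  | no a∉Y = contradiction
        ((u , u∈Y , ∈-∪ u∈ u∉S) , (v , v∈Y , v∉X) , (a , a∈X , a∉Y)) ¬YX
      exceeds : Exceeds S Y
      exceeds with w ∈? S | a ∈? Y
      ... | yes w∈S | _ = w , w∈S , w∉Y
      ... | no _    | no a∉Y = a , a∈S , a∉Y
      ... | no w∉S  | yes a∈Y = contradiction
        ((a , a∈Y , a∈X) , (v , v∈Y , v∉X) , (w , ∈-∪ w∈ w∉S , w∉Y)) ¬YX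

    cross-─ˡ : Cross Y (S ─ X) → Cross Y S
    cross-─ˡ ((u , u∈Y , u∈) , (v , v∈Y , v∉) , (w , w∈ , w∉Y)) =
      (u , u∈Y , p─q⊆p S X u∈) , exceeds , (w , p─q⊆p S X w∈ , w∉Y)
      where
      exceeds : Exceeds Y S
      exceeds with v ∈? S | proj₁ (proj₂ XS)
      ... | no v∉S  | _ = v , v∈Y , v∉S
      ... | yes v∈S | b , b∈X , b∉S with b ∈? Y | v ∈? X
      ...   | yes b∈Y | _ = b , b∈Y , b∉S
      ...   | no _    | no v∉X = contradiction (x∈p∧x∉q⇒x∈p─q v∈S v∉X) v∉
      ...   | no b∉Y  | yes v∈X = contradiction
        ((v , v∈Y , v∈X) , (u , u∈Y , x∈p─q⇒x∉q S X u∈) , (b , b∈X , b∉Y)) ¬YX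

    cross-─ʳ : Cross Y (X ─ S) → Cross Y S
    cross-─ʳ ((u , u∈Y , u∈) , (v , v∈Y , v∉) , (w , w∈ , w∉Y)) =
      meets , (u , u∈Y , x∈p─q⇒x∉q X S u∈) , exceeds
      where
      u∈X = p─q⊆p X S u∈
      w∈X = p─q⊆p X S w∈
      meets : Meets Y S
      meets with v ∈? S | v ∈? X
      ... | yes v∈S | _ = v , v∈Y , v∈S
      ... | no v∉S  | yes v∈X = contradiction (x∈p∧x∉q⇒x∈p─q v∈X v∉S) v∉
      ... | no _    | no v∉X = contradiction
        ((u , u∈Y , u∈X) , (v , v∈Y , v∉X) , (w , w∈X , w∉Y)) ¬YX
      exceeds : Exceeds S Y
      exceeds with proj₂ (proj₂ XS)
      ... | d , d∈S , d∉X with d ∈? Y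
      ...   | no d∉Y  = d , d∈S , d∉Y
      ...   | yes d∈Y = contradiction ((u , u∈Y , u∈X) , (d , d∈Y , d∉X) , (w , w∈X , w∉Y)) ¬YX

  Laminar : List (Subset n) → Set
  Laminar L = ∀ {X Y} → X ∈ˡ L → Y ∈ˡ L → ¬ Cross X Y

  -- Greedy choice along the list. A set is rejected only because a chosen member crosses it, and
  -- that member stays in the family as it grows.
  maximal-laminar : {M : Subset n → Set} → Decidable M → (xs : List (Subset n)) →
    ∃[ L ] ((∀ {S} → S ∈ˡ L → M S) × Laminar L ×
            (∀ {S} → S ∈ˡ xs → M S → S ∈ˡ L ⊎ (∃[ Y ] (Y ∈ˡ L × Cross Y S))))
  maximal-laminar M? [] = [] , (λ ()) , (λ ()) , λ ()
  maximal-laminar {M} M? (S ∷ xs) with maximal-laminar M? xs | M? S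
  ... | L , L⊆M , lam , max | no ¬MS = L , L⊆M , lam , λ where
    (here refl) MS → contradiction MS ¬MS
    (there S∈)  → max S∈
  ... | L , L⊆M , lam , max | yes MS with Any.any? (λ Y → cross? Y S) L
  ...   | yes crossed = L , L⊆M , lam , λ where
    (here refl) _ → inj₂ (find crossed)
    (there S∈)    → max S∈
  ...   | no ¬crossed = S ∷ L , L⊆M′ , lam′ , max′
    where
    L⊆M′ : ∀ {X} → X ∈ˡ S ∷ L → M X
    L⊆M′ (here refl) = MS
    L⊆M′ (there X∈)  = L⊆M X∈
    lam′ : Laminar (S ∷ L)
    lam′ (here refl) (here refl) (_ , (_ , v∈ , v∉) , _) = v∉ v∈
    lam′ (here refl) (there Y∈)  SY = ¬crossed (lose Y∈ (cross-sym SY))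
    lam′ (there X∈)  (here refl) XS = ¬crossed (lose X∈ XS)
    lam′ (there X∈)  (there Y∈)  = lam X∈ Y∈
    max′ : ∀ {X} → X ∈ˡ S ∷ xs → M X → X ∈ˡ S ∷ L ⊎ (∃[ Y ] (Y ∈ˡ S ∷ L × Cross Y X))
    max′ (here refl) _ = inj₁ (here refl)
    max′ (there X∈) MX with max X∈ MX
    ... | inj₁ X∈L = inj₁ (there X∈L)
    ... | inj₂ (Y , Y∈L , YX) = inj₂ (Y , there Y∈L , YX)

  -- `X` plays the family member, for which `P` is already known; a four-term relation then carries
  -- `P` from `X` and the two new sets to `S`. Which pair of new sets stays within `M` depends on
  -- `S` and `X`, hence the two alternatives.
  Uncrosses : (M P : Subset n → Set) → Set
  Uncrosses M P = ∀ {S X} → M S → M X → P X → Cross X S →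
    (M (S ∩ X) × M (S ∪ X) × (P (S ∩ X) → P (S ∪ X) → P S)) ⊎
    (M (S ─ X) × M (X ─ S) × (P (S ─ X) → P (X ─ S) → P S))

  -- Recursion on a list containing all members of L that cross S: uncrossing
  -- with its head X leaves only sets crossed by members in its tail.
  laminar-generates : ∀ {M P : Subset n → Set} {L} → Laminar L →
    (∀ {S} → S ∈ˡ L → M S) → (∀ {S} → S ∈ˡ L → P S) → Uncrosses M P →
    (∀ {S} → M S → S ∈ˡ L ⊎ (∃[ Y ] (Y ∈ˡ L × Cross Y S))) →
    ∀ {S} → M S → P S
  laminar-generates {M} {P} {L} lam L⊆M L⊆P uncross max MS = go L id MS (λ Y∈ _ → Y∈)
    where
    go : ∀ K → (∀ {X} → X ∈ˡ K → X ∈ˡ L) → ∀ {S} → M S →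
         (∀ {Y} → Y ∈ˡ L → Cross Y S → Y ∈ˡ K) → P S
    go [] K⊆L MS crossing with max MS
    ... | inj₁ S∈L = L⊆P S∈L
    ... | inj₂ (Y , Y∈L , YS) with crossing Y∈L YS
    ...   | ()
    go (X ∷ K) K⊆L {S} MS crossing = resolve (cross? X S)
      where
      recurse : ∀ {Z} → ¬ Cross X Z → (∀ {Y} → Y ∈ˡ L → Cross Y Z → Cross Y S) → M Z → P Z
      recurse {Z} ¬XZ YZ⇒YS MZ = go K (K⊆L ∘ there) MZ λ Y∈L YZ → tail YZ (crossing Y∈L (YZ⇒YS Y∈L YZ))
        where
        tail : ∀ {Y} → Cross Y Z → Y ∈ˡ X ∷ K → Y ∈ˡ K
        tail XZ (here refl) = contradiction XZ ¬XZ
        tail _  (there Y∈)  = Y∈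

      ¬YX : ∀ {Y} → Y ∈ˡ L → ¬ Cross Y X
      ¬YX Y∈L = lam Y∈L (K⊆L (here refl))

      resolve : Dec (Cross X S) → P S
      resolve (no ¬XS) = recurse ¬XS (λ _ → id) MS
      resolve (yes XS) with uncross MS (L⊆M (K⊆L (here refl))) (L⊆P (K⊆L (here refl))) XS
      ... | inj₁ (M∩ , M∪ , combine) = combine
        (recurse (¬cross-∩ S X) (λ Y∈L → cross-∩ (¬YX Y∈L) XS) M∩)
        (recurse (¬cross-∪ S X) (λ Y∈L → cross-∪ (¬YX Y∈L) XS) M∪)
      ... | inj₂ (M─ˡ , M─ʳ , combine) = combine
        (recurse (¬cross-─ˡ S X) (λ Y∈L → cross-─ˡ (¬YX Y∈L) XS) M─ˡ)
        (recurse (¬cross-─ʳ S X) (λ Y∈L → cross-─ʳ (¬YX Y∈L) XS) M─ʳ)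

  -- Counting the members of a laminar family by nodes and terminals

  least : ∀ {Q : Subset n → Set} → Decidable Q → List (Subset n) → Subset n
  least Q? L = ⋂ (filter Q? L)

  ⋂-greatest : ∀ {S : Subset n} (L : List (Subset n)) → (∀ {X} → X ∈ˡ L → S ⊆ X) → S ⊆ ⋂ L
  ⋂-greatest []      S⊆ v∈S = ∈⊤
  ⋂-greatest (X ∷ L) S⊆ v∈S = x∈p∩q⁺ (S⊆ (here refl) v∈S , ⋂-greatest L (S⊆ ∘ there) v∈S)

  ⋂-lower : ∀ {X : Subset n} (L : List (Subset n)) → X ∈ˡ L → ⋂ L ⊆ X
  ⋂-lower (X ∷ L) (here refl) v∈ = p∩q⊆p X (⋂ L) v∈
  ⋂-lower (X ∷ L) (there X∈)  v∈ = ⋂-lower L X∈ (p∩q⊆q X (⋂ L) v∈)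

  ≡least : ∀ {Q : Subset n → Set} (Q? : Decidable Q) {L S} → S ∈ˡ L → Q S →
           (∀ {X} → X ∈ˡ L → Q X → S ⊆ X) → S ≡ least Q? L
  ≡least Q? {L} S∈L QS S⊆ = ⊆-antisym
    (⋂-greatest (filter Q? L) λ X∈ → let X∈L , QX = ∈-filter⁻ Q? {xs = L} X∈ in S⊆ X∈L QX)
    (⋂-lower (filter Q? L) (∈-filter⁺ Q? S∈L QS))

  chain-maximum : ∀ {Q : Subset n → Set} → Decidable Q → ∀ L →
    (∀ {X Y} → X ∈ˡ L → Y ∈ˡ L → Q X → Q Y → X ⊆ Y ⊎ Y ⊆ X) →
    (∃[ X ] (X ∈ˡ L × Q X)) → ∃[ Z ] (Z ∈ˡ L × Q Z × (∀ {X} → X ∈ˡ L → Q X → X ⊆ Z))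
  chain-maximum {Q} Q? (S ∷ L) chain (X , X∈ , QX) with Any.any? Q? L
  ... | no ¬Q = X , X∈ , QX , λ X′∈ QX′ → only X∈ QX X′∈ QX′
    where
    only : ∀ {X Y} → X ∈ˡ S ∷ L → Q X → Y ∈ˡ S ∷ L → Q Y → Y ⊆ X
    only (here refl) _  (here refl) _  = id
    only (there X∈)  QX _           _  = contradiction (lose X∈ QX) ¬Q
    only _           _  (there Y∈)  QY = contradiction (lose Y∈ QY) ¬Q
  ... | yes anyQ with chain-maximum Q? L (λ X∈ Y∈ → chain (there X∈) (there Y∈)) (find anyQ) | Q? S
  ...   | Z , Z∈ , QZ , max | no ¬QS = Z , there Z∈ , QZ , λ where
    (here refl) QS → contradiction QS ¬QS
    (there X∈)  QX → max X∈ QX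
  ...   | Z , Z∈ , QZ , max | yes QS with chain (here refl) (there Z∈) QS QZ
  ...     | inj₁ S⊆Z = Z , there Z∈ , QZ , λ where
    (here refl) _  → S⊆Z
    (there X∈)  QX → max X∈ QX
  ...     | inj₂ Z⊆S = S , here refl , QS , λ where
    (here refl) _  → id
    (there X∈)  QX → Z⊆S ∘ max X∈ QX

least-element : ∀ {n} {P : Fin n → Set} → Decidable P → ∃ P →
                ∃[ t ] (P t × (∀ u → P u → t Fin.≤ u))
least-element {suc n} P? (v , Pv) with P? zero
... | yes P0 = zero , P0 , λ _ _ → ℕ.z≤n
least-element {suc n} P? (zero  , Pv) | no ¬P0 = contradiction Pv ¬P0
least-element {suc n} {P} P? (suc v , Pv) | no ¬P0 with least-element (P? ∘ suc) (v , Pv)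
... | t , Pt , least = suc t , Pt , min
  where
  min : ∀ u → P u → suc t Fin.≤ u
  min zero    P0 = contradiction P0 ¬P0
  min (suc u) Pu = ℕ.s≤s (least u Pu)

module _ {n : ℕ} (T : Subset n) where

  -- The least terminal of a set is its leader. Along a chain of sets through a terminal `t`, once
  -- `t` has stopped leading it never leads again; the smallest member that contains `t` under
  -- another leader is the one charged to `t`.
  Leads : Fin n → Subset n → Set
  Leads t S = ∀ u → u ∈ T × u ∈ S → t Fin.≤ u

  leads? : ∀ t → Decidable (Leads t)
  leads? t S = Fin.all? λ u → (u ∈? T ×-dec u ∈? S) →-dec (t Fin.≤? u)

  leader : ∀ {S} → Meets T S → ∃[ t ] ((t ∈ T × t ∈ S) × Leads t S)
  leader {S} = least-element (λ u → u ∈? T ×-dec u ∈? S)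

  Led : Fin n → Subset n → Set
  Led t S = t ∈ S × ¬ Leads t S

  led? : ∀ t → Decidable (Led t)
  led? t S = t ∈? S ×-dec ¬? (leads? t S)

  -- One entry for each node and one for each terminal. Where no member qualifies, `least` returns
  -- the full set; such entries only pad the list, so that its length is known exactly.
  representatives : List (Subset n) → List (Subset n)
  representatives L = map (λ v → least (v ∈?_) L) (allFin n) ++
                      map (λ t → least (led? t) L) (elements T)

  length-representatives : ∀ L → length (representatives L) ≡ n ℕ.+ ∣ T ∣
  length-representatives L = trans (length-++ (map (λ v → least (v ∈?_) L) (allFin n)))
    (cong₂ ℕ._+_ (trans (length-map _ (allFin n)) (length-tabulate {n = n} id))
                 (trans (length-map _ (elements T)) (length-elements T)))

  module _ {L : List (Subset n)} (lam : Laminar L) (terminal : ∀ {S} → S ∈ˡ L → Meets T S) where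

    -- For `v` in `S` and members `S` and `X` of the laminar family this says that `X` is a proper
    -- subset of `S` through `v`.
    Part : Subset n → Fin n → Subset n → Set
    Part S v X = v ∈ X × ¬ (S ⊆ X)

    part? : ∀ S v → Decidable (Part S v)
    part? S v X = v ∈? X ×-dec ¬? (S ⊆? X)

    MaximalPart : Subset n → Fin n → Subset n → Set
    MaximalPart S v Z = Z ∈ˡ L × Part S v Z × (∀ {X} → X ∈ˡ L → Part S v X → X ⊆ Z)

    maximal-part : ∀ {S v} → (∃[ X ] (X ∈ˡ L × Part S v X)) → ∃ (MaximalPart S v)
    maximal-part {S} {v} = chain-maximum (part? S v) L
      λ X∈L Y∈L (v∈X , _) (v∈Y , _) → nested (lam X∈L Y∈L) (v , v∈X , v∈Y)

    part⊆ : ∀ {S X v} → S ∈ˡ L → v ∈ S → X ∈ˡ L → Part S v X → X ⊆ S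
    part⊆ {v = v} S∈L v∈S X∈L (v∈X , S⊈X) with nested (lam S∈L X∈L) (v , v∈S , v∈X)
    ... | inj₁ S⊆X = ⊥-elim (S⊈X S⊆X)
    ... | inj₂ X⊆S = X⊆S

    -- If every element of S lies in a smaller member, take the maximal such
    -- member P through the leader of S, a maximal such member R through an
    -- element outside P, and the leader t of R. Then S is the least member
    -- that contains t without being led by it.
    divided : ∀ {S} → S ∈ˡ L → (∀ {v} → v ∈ S → ∃[ X ] (X ∈ˡ L × Part S v X)) →
              ∃[ t ] (t ∈ T × Led t S × (∀ {X} → X ∈ˡ L → Led t X → S ⊆ X))
    divided {S} S∈L parts with leader (terminal S∈L)
    ... | j , (j∈T , j∈S) , j≤ with maximal-part (parts j∈S)
    ...   | P , P∈L , (j∈P , S⊈P) , maxP with exceeds? S P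
    ...     | no ¬S\P = ⊥-elim (S⊈P (¬exceeds⇒⊆ ¬S\P))
    ...     | yes (v , v∈S , v∉P) with maximal-part (parts v∈S)
    ...       | R , R∈L , (v∈R , S⊈R) , maxR with leader (terminal R∈L)
    ...         | t , (t∈T , t∈R) , t≤ = t , t∈T , (t∈S , ¬leads) , S⊆
      where
      t∈S : t ∈ S
      t∈S = part⊆ S∈L v∈S R∈L (v∈R , S⊈R) t∈R

      j∉R : j ∉ R
      j∉R j∈R = v∉P (maxP R∈L (j∈R , S⊈R) v∈R)

      ¬leads : ¬ Leads t S
      ¬leads leads = j∉R (subst (_∈ R) (Fin.≤-antisym (leads j (j∈T , j∈S)) (j≤ t (t∈T , t∈S))) t∈R)

      -- A member through `t` that does not contain `S` lies inside `R`, where `t` is the leader, so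
      -- `t` leads it as well. Hence members that `t` does not lead contain `S`.
      X⊆R : ∀ {X} → X ∈ˡ L → t ∈ X → ¬ (S ⊆ X) → X ⊆ R
      X⊆R X∈L t∈X S⊈X with nested (lam X∈L R∈L) (t , t∈X , t∈R)
      ... | inj₁ X⊆R = X⊆R
      ... | inj₂ R⊆X = maxR X∈L (R⊆X v∈R , S⊈X)

      S⊆ : ∀ {X} → X ∈ˡ L → Led t X → S ⊆ X
      S⊆ {X} X∈L (t∈X , ¬t≤) with S ⊆? X
      ... | yes S⊆X = S⊆X
      ... | no  S⊈X = contradiction (λ u (u∈T , u∈X) → t≤ u (u∈T , X⊆R X∈L t∈X S⊈X u∈X)) ¬t≤

    -- If some node of `S` lies in no smaller member, `S` is the least member through that node.
    -- Otherwise the smaller members cover `S`, and `divided` supplies a terminal.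
    laminar-representatives : ∀ {S} → S ∈ˡ L → S ∈ˡ representatives L
    laminar-representatives {S} S∈L
      with Fin.any? (λ v → v ∈? S ×-dec ¬? (Any.any? (part? S v) L))
    ... | yes (v , v∈S , ¬part) = ∈-++⁺ˡ (subst (_∈ˡ map (λ v → least (v ∈?_) L) (allFin n))
      (sym (≡least (v ∈?_) S∈L v∈S S⊆)) (∈-map⁺ (λ v → least (v ∈?_) L) (∈-allFin v)))
      where
      S⊆ : ∀ {X} → X ∈ˡ L → v ∈ X → S ⊆ X
      S⊆ {X} X∈L v∈X with S ⊆? X
      ... | yes S⊆X = S⊆X
      ... | no  S⊈X = contradiction (lose X∈L (v∈X , S⊈X)) ¬part
    ... | no ¬private with divided S∈L parts
      where
      parts : ∀ {v} → v ∈ S → ∃[ X ] (X ∈ˡ L × Part S v X)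
      parts {v} v∈S with Any.any? (part? S v) L
      ... | yes part = find part
      ... | no ¬part = contradiction (v , v∈S , ¬part) ¬private
    ...   | t , t∈T , led , S⊆ = ∈-++⁺ʳ _ (subst (_∈ˡ map (λ t → least (led? t) L) (elements T))
      (sym (≡least (led? t) S∈L led S⊆)) (∈-map⁺ (λ t → least (led? t) L) (∈-elements t∈T)))

-- Uncrossing minimum cuts

sum-mono-≤ : ∀ {m} {f g : Vector ℕ m} → (∀ i → f i ℕ.≤ g i) → Σℕ.sum f ℕ.≤ Σℕ.sum g
sum-mono-≤ {zero}  f≤g = ℕ.z≤n
sum-mono-≤ {suc m} f≤g = ℕ.+-mono-≤ (f≤g zero) (sum-mono-≤ λ i → f≤g (suc i))

sum-tight : ∀ {m} {f g : Vector ℕ m} → (∀ i → f i ℕ.≤ g i) → Σℕ.sum g ℕ.≤ Σℕ.sum f → ∀ i → f i ≡ g i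
sum-tight {suc m} {f} {g} f≤g Σg≤Σf zero = ℕ.≤-antisym (f≤g zero)
  (ℕ.+-cancelʳ-≤ _ _ _ (ℕ.≤-trans Σg≤Σf (ℕ.+-monoʳ-≤ (f zero) (sum-mono-≤ λ i → f≤g (suc i)))))
sum-tight {suc m} {f} {g} f≤g Σg≤Σf (suc i) = sum-tight (λ i → f≤g (suc i))
  (ℕ.+-cancelˡ-≤ _ _ _ (ℕ.≤-trans Σg≤Σf (ℕ.+-monoˡ-≤ _ (f≤g zero)))) i

∀Bool? : ∀ {P : Bool → Set} → (∀ b → Dec (P b)) → Dec (∀ b → P b)
∀Bool? P? = map′ (λ { (t , f) true → t ; (t , f) false → f }) (λ h → h true , h false)
  (P? true ×-dec P? false)

bit : Bool → ℕ
bit b = if b then 1 else 0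

-- A pair of Boolean operations, applied pointwise to two node sets, does not
-- increase the total number of times an edge is cut.
CutReducing : (f g : Bool → Bool → Bool) → Set
CutReducing f g = ∀ a b c d →
  bit (f a b xor f c d) ℕ.+ bit (g a b xor g c d) ℕ.≤ bit (a xor c) ℕ.+ bit (b xor d)

-- Only the membership of the two ends of an edge in the two sets matters, so each instance is an
-- evaluation of sixteen cases.
cutReducing? : ∀ f g → Dec (CutReducing f g)
cutReducing? f g = ∀Bool? λ a → ∀Bool? λ b → ∀Bool? λ c → ∀Bool? λ d →
  bit (f a b xor f c d) ℕ.+ bit (g a b xor g c d) ℕ.≤? bit (a xor c) ℕ.+ bit (b xor d)

submodular : CutReducing _∧_ _∨_
submodular = from-yes (cutReducing? _∧_ _∨_)

_∖_ : Bool → Bool → Bool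
a ∖ b = a ∧ not b

posimodular : CutReducing _∖_ (flip _∖_)
posimodular = from-yes (cutReducing? _∖_ (flip _∖_))

lookup-─ : ∀ {n} (p q : Subset n) v → lookup (p ─ q) v ≡ lookup p v ∖ lookup q v
lookup-─ (false ∷ p) (true  ∷ q) zero    = refl
lookup-─ (false ∷ p) (false ∷ q) zero    = refl
lookup-─ (true  ∷ p) (true  ∷ q) zero    = refl
lookup-─ (true  ∷ p) (false ∷ q) zero    = refl
lookup-─ (_ ∷ p)     (_ ∷ q)     (suc v) = lookup-─ p q v

module MinimumCuts (G : SteinerGraph) (c : Vector ℕ (SteinerGraph.m G)) (c>0 : ∀ e → 0 ℕ.< c e)
                   (γ : ℕ) (γ-min : ∀ F → SteinerCut G F → γ ℕ.≤ weight c F)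
                   (r : SteinerGraph.V G) (r∈T : r ∈ SteinerGraph.T G) where
  open SteinerGraph G

  cutBit : Subset n → E → ℕ
  cutBit S e = bit (lookup (δ S) e)

  cutBit-xor : ∀ S e → cutBit S e ≡ bit (lookup S (src e) xor lookup S (tgt e))
  cutBit-xor S e = cong bit (lookup∘tabulate _ e)

  weight-sum : ∀ F → weight c F ≡ Σℕ.sum (λ e → c e ℕ.* bit (lookup F e))
  weight-sum F = Σℕ.sum-cong-≗ λ e → scale (lookup F e) (c e)
    where
    scale : ∀ b k → (if b then k else 0) ≡ k ℕ.* bit b
    scale true  k = sym (ℕ.*-identityʳ k)
    scale false k = sym (ℕ.*-zeroʳ k)

  -- Rooted minimum cuts: each minimum Steiner cut is δ(S) for a unique S
  -- that avoids r.
  Minimum : Subset n → Set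
  Minimum S = r ∉ S × Meets T S × weight c (δ S) ≡ γ

  minimum? : ∀ S → Dec (Minimum S)
  minimum? S = ¬? (r ∈? S) ×-dec Fin.any? (λ v → v ∈? T ×-dec v ∈? S) ×-dec (weight c (δ S) ℕ.≟ γ)

  γ≤ : ∀ {S} → r ∉ S → Meets T S → γ ℕ.≤ weight c (δ S)
  γ≤ {S} r∉S (t , t∈T , t∈S) = γ-min (δ S)
    (S , refl , (t , x∈p∩q⁺ (t∈T , t∈S)) , (r , x∈p∧x∉q⇒x∈p─q r∈T r∉S))

  -- The four-term relation between incidence vectors, stated in natural numbers; `χ-balance`
  -- carries it over to the reals.
  Balanced : (S X A B : Subset n) → Set
  Balanced S X A B = ∀ e → cutBit S e ℕ.+ cutBit X e ≡ cutBit A e ℕ.+ cutBit B e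

  -- The chain `2 γ ≤ w A + w B ≤ w S + w X = 2 γ` is tight throughout. Tightness of the weighted
  -- sum is tightness on every edge because all weights are positive.
  balance : ∀ {S X A B} → (∀ e → cutBit A e ℕ.+ cutBit B e ℕ.≤ cutBit S e ℕ.+ cutBit X e) →
            weight c (δ S) ≡ γ → weight c (δ X) ≡ γ → γ ℕ.≤ weight c (δ A) → γ ℕ.≤ weight c (δ B) →
            weight c (δ A) ≡ γ × weight c (δ B) ≡ γ × Balanced S X A B
  balance {S} {X} {A} {B} AB≤SX wS wX γ≤A γ≤B =
    ℕ.≤-antisym (ℕ.+-cancelʳ-≤ _ _ _ (ℕ.≤-trans (ℕ.+-monoʳ-≤ _ γ≤B) wAB≤)) γ≤A ,
    ℕ.≤-antisym (ℕ.+-cancelˡ-≤ _ _ _ (ℕ.≤-trans (ℕ.+-monoˡ-≤ _ γ≤A) wAB≤)) γ≤B ,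
    λ e → sym (ℕ.*-cancelˡ-≡ _ _ (c e) ⦃ ℕ.>-nonZero (c>0 e) ⦄
      (sum-tight scaled≤ (subst₂ ℕ._≤_ (pair S X) (pair A B) wSX≤) e))
    where
    pair : ∀ Y Z → weight c (δ Y) ℕ.+ weight c (δ Z) ≡
                   Σℕ.sum (λ e → c e ℕ.* (cutBit Y e ℕ.+ cutBit Z e))
    pair Y Z = trans (cong₂ ℕ._+_ (weight-sum (δ Y)) (weight-sum (δ Z)))
      (trans (sym (Σℕ.∑-distrib-+ (λ e → c e ℕ.* cutBit Y e) (λ e → c e ℕ.* cutBit Z e)))
        (Σℕ.sum-cong-≗ λ e → sym (ℕ.*-distribˡ-+ (c e) (cutBit Y e) (cutBit Z e))))

    scaled≤ : ∀ e → c e ℕ.* (cutBit A e ℕ.+ cutBit B e) ℕ.≤ c e ℕ.* (cutBit S e ℕ.+ cutBit X e)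
    scaled≤ e = ℕ.*-monoʳ-≤ (c e) (AB≤SX e)

    wAB≤ : weight c (δ A) ℕ.+ weight c (δ B) ℕ.≤ γ ℕ.+ γ
    wAB≤ = subst₂ ℕ._≤_ (sym (pair A B)) (trans (sym (pair S X)) (cong₂ ℕ._+_ wS wX))
      (sum-mono-≤ scaled≤)

    wSX≤ : weight c (δ S) ℕ.+ weight c (δ X) ℕ.≤ weight c (δ A) ℕ.+ weight c (δ B)
    wSX≤ = subst (ℕ._≤ weight c (δ A) ℕ.+ weight c (δ B)) (sym (cong₂ ℕ._+_ wS wX))
      (ℕ.+-mono-≤ γ≤A γ≤B)

  cutBits≤ : ∀ f g → CutReducing f g → ∀ S X A B →
             (∀ v → lookup A v ≡ f (lookup S v) (lookup X v)) →
             (∀ v → lookup B v ≡ g (lookup S v) (lookup X v)) →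
             ∀ e → cutBit A e ℕ.+ cutBit B e ℕ.≤ cutBit S e ℕ.+ cutBit X e
  cutBits≤ f g ineq S X A B eA eB e = subst₂ ℕ._≤_
    (sym (cong₂ ℕ._+_
      (trans (cutBit-xor A e) (cong₂ (λ a b → bit (a xor b)) (eA (src e)) (eA (tgt e))))
      (trans (cutBit-xor B e) (cong₂ (λ a b → bit (a xor b)) (eB (src e)) (eB (tgt e))))))
    (sym (cong₂ ℕ._+_ (cutBit-xor S e) (cutBit-xor X e)))
    (ineq (lookup S (src e)) (lookup X (src e)) (lookup S (tgt e)) (lookup X (tgt e)))

  -- All new sets avoid `r`, so each defines a Steiner cut once it contains a terminal. If `S ∩ X`
  -- has one, so does `S ∪ X`; if not, the terminals of `S` and of `X` lie in the two differences.
  uncross : ∀ {S X} → Minimum S → Minimum X →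
    (Minimum (S ∩ X) × Minimum (S ∪ X) × Balanced S X (S ∩ X) (S ∪ X)) ⊎
    (Minimum (S ─ X) × Minimum (X ─ S) × Balanced S X (S ─ X) (X ─ S))
  uncross {S} {X} (r∉S , (s , s∈T , s∈S) , wS) (r∉X , (x , x∈T , x∈X) , wX)
    with Fin.any? (λ v → v ∈? T ×-dec v ∈? (S ∩ X))
  ... | yes (t , t∈T , t∈) =
    let wA , wB , bal = balance {S} {X} {A = S ∩ X} {B = S ∪ X}
          (cutBits≤ _∧_ _∨_ submodular S X (S ∩ X) (S ∪ X)
            (λ v → lookup-zipWith _∧_ v S X) (λ v → lookup-zipWith _∨_ v S X))
          wS wX (γ≤ r∉A (t , t∈T , t∈)) (γ≤ r∉B (s , s∈T , x∈p∪q⁺ (inj₁ s∈S)))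
    in inj₁ ((r∉A , (t , t∈T , t∈) , wA) , (r∉B , (s , s∈T , x∈p∪q⁺ (inj₁ s∈S)) , wB) , bal)
    where
    r∉A : r ∉ S ∩ X
    r∉A r∈ = r∉S (p∩q⊆p S X r∈)
    r∉B : r ∉ S ∪ X
    r∉B r∈ = r∉X (∈-∪ r∈ r∉S)
  ... | no ¬meets =
    let wA , wB , bal = balance {S} {X} {A = S ─ X} {B = X ─ S}
          (cutBits≤ _∖_ (flip _∖_) posimodular S X (S ─ X) (X ─ S) (lookup-─ S X) (lookup-─ X S))
          wS wX (γ≤ r∉A (s , s∈T , s∈A)) (γ≤ r∉B (x , x∈T , x∈B))
    in inj₂ ((r∉A , (s , s∈T , s∈A) , wA) , (r∉B , (x , x∈T , x∈B) , wB) , bal)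
    where
    r∉A : r ∉ S ─ X
    r∉A r∈ = r∉S (p─q⊆p S X r∈)
    r∉B : r ∉ X ─ S
    r∉B r∈ = r∉X (p─q⊆p X S r∈)
    s∈A : s ∈ S ─ X
    s∈A = x∈p∧x∉q⇒x∈p─q s∈S λ s∈X → ¬meets (s , s∈T , x∈p∩q⁺ (s∈S , s∈X))
    x∈B : x ∈ X ─ S
    x∈B = x∈p∧x∉q⇒x∈p─q x∈X λ x∈S → ¬meets (x , x∈T , x∈p∩q⁺ (x∈S , x∈X))

  δ-∁ : ∀ S → δ (∁ S) ≡ δ S
  δ-∁ S = tabulate-cong λ e → trans (cong₂ _xor_ (lookup-map (src e) not S) (lookup-map (tgt e) not S))
    (xor-annihilates-not (lookup S (src e)) (lookup S (tgt e)))

  rooted : ∀ {F} → SteinerCut G F → weight c F ≡ γ → ∃[ S ] (Minimum S × δ S ≡ F)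
  rooted (S , refl , (t , t∈) , (u , u∈)) wF with r ∈? S
  ... | no r∉S = S , (r∉S , (t , x∈p∩q⁻ T S t∈) , wF) , refl
  ... | yes r∈S = ∁ S , (x∈p⇒x∉∁p r∈S , (u , p─q⊆p T S u∈ , x∉p⇒x∈∁p (x∈p─q⇒x∉q T S u∈)) ,
    trans (cong (weight c) (δ-∁ S)) wF) , δ-∁ S

-- Degrees

∣p∣≡sum : ∀ {n} (p : Subset n) → ∣ p ∣ ≡ Σℕ.sum (λ v → bit (lookup p v))
∣p∣≡sum []          = refl
∣p∣≡sum (true  ∷ p) = cong suc (∣p∣≡sum p)
∣p∣≡sum (false ∷ p) = ∣p∣≡sum p

lookup-⁅⁆-comm : ∀ {n} (u v : Fin n) → lookup ⁅ u ⁆ v ≡ lookup ⁅ v ⁆ u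
lookup-⁅⁆-comm zero    zero    = refl
lookup-⁅⁆-comm zero    (suc v) = lookup-replicate v outside
lookup-⁅⁆-comm (suc u) zero    = sym (lookup-replicate u outside)
lookup-⁅⁆-comm (suc u) (suc v) = lookup-⁅⁆-comm u v

∉⇒lookup : ∀ {n} {v : Fin n} {p : Subset n} → v ∉ p → lookup p v ≡ outside
∉⇒lookup {v = v} {p} v∉p with lookup p v in eq
... | false = refl
... | true  = contradiction (lookup⇒[]= v p eq) v∉p

2≤∣p∣ : ∀ {n} {p : Subset n} {u v} → u ∈ p → v ∈ p → u ≢ v → 2 ℕ.≤ ∣ p ∣
2≤∣p∣ u∈p v∈p u≢v = ℕ.≤-trans
  (ℕ.s≤s (ℕ.≤-trans (ℕ.s≤s ℕ.z≤n) (x∈p⇒∣p-x∣<∣p∣ (x∈p∧x≢y⇒x∈p-y v∈p (≢-sym u≢v)))))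
  (x∈p⇒∣p-x∣<∣p∣ u∈p)

other-element : ∀ {n} {p : Subset n} → 2 ℕ.≤ ∣ p ∣ → ∀ w → ∃[ u ] (u ∈ p × u ≢ w)
other-element {p = p} 2≤ w with Fin.any? (λ u → u ∈? p ×-dec ¬? (u Fin.≟ w))
... | yes found = found
... | no ¬found = ⊥-elim (ℕ.<⇒≱ 2≤ (subst (∣ p ∣ ℕ.≤_) (∣⁅x⁆∣≡1 w) (p⊆q⇒∣p∣≤∣q∣ p⊆⁅w⁆)))
  where
  p⊆⁅w⁆ : p ⊆ ⁅ w ⁆
  p⊆⁅w⁆ {u} u∈p with u Fin.≟ w
  ... | yes refl = x∈⁅x⁆ w
  ... | no u≢w   = contradiction (u , u∈p , u≢w) ¬found

module Degrees (G : Graph) where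
  open Graph G

  adjacent⇒≢ : ∀ {u v} → Adjacent u v → u ≢ v
  adjacent⇒≢ (e , inj₁ (refl , refl)) s≡t = Fin.<⇒≢ (src<tgt e) s≡t
  adjacent⇒≢ (e , inj₂ (refl , refl)) t≡s = Fin.<⇒≢ (src<tgt e) (sym t≡s)

  adjacent⇒∈δ : ∀ {u v} (a : Adjacent u v) → proj₁ a ∈ δ ⁅ u ⁆
  adjacent⇒∈δ {u} {v} a@(e , ends) = lookup⇒[]= e (δ ⁅ u ⁆) (trans (lookup∘tabulate _ e) (cut ends))
    where
    at-u : lookup ⁅ u ⁆ u ≡ true
    at-u = []=⇒lookup (x∈⁅x⁆ u)
    at-v : lookup ⁅ u ⁆ v ≡ false
    at-v = ∉⇒lookup (x≢y⇒x∉⁅y⁆ (≢-sym (adjacent⇒≢ a)))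
    cut : (src e ≡ u × tgt e ≡ v) ⊎ (src e ≡ v × tgt e ≡ u) →
          lookup ⁅ u ⁆ (src e) xor lookup ⁅ u ⁆ (tgt e) ≡ true
    cut (inj₁ (refl , refl)) = cong₂ _xor_ at-u at-v
    cut (inj₂ (refl , refl)) = cong₂ _xor_ at-v at-u

  same-edge : ∀ {u v w} (a : Adjacent u v) (b : Adjacent u w) → proj₁ a ≡ proj₁ b → v ≡ w
  same-edge (e , inj₁ (refl , refl)) (.e , inj₁ (_ , t≡)) refl = t≡
  same-edge (e , inj₂ (refl , refl)) (.e , inj₂ (s≡ , _)) refl = s≡
  same-edge a@(e , inj₁ (refl , refl)) (.e , inj₂ (_ , t≡)) refl = contradiction (sym t≡) (adjacent⇒≢ a)
  same-edge a@(e , inj₂ (refl , refl)) (.e , inj₁ (s≡ , _)) refl = contradiction (sym s≡) (adjacent⇒≢ a)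

  neighbour : ∀ {U u v} → u ≢ v → Star (λ a b → a ∈ U × b ∈ U × Adjacent a b) u v →
              ∃[ w ] (w ∈ U × Adjacent u w)
  neighbour u≢v Star.ε                     = contradiction refl u≢v
  neighbour u≢v ((_ , w∈U , u~w) ◅ _) = _ , w∈U , u~w

  -- Double counting of incident pairs of a node and an edge, where each edge is charged to its two
  -- ends.
  degree-sum : Σℕ.sum degree ℕ.≤ m ℕ.* 2
  degree-sum = begin
    Σℕ.sum degree
      ≡⟨ Σℕ.sum-cong-≗ (λ v → ∣p∣≡sum (δ ⁅ v ⁆)) ⟩
    Σℕ.sum (λ v → Σℕ.sum (λ e → bit (lookup (δ ⁅ v ⁆) e)))
      ≡⟨ Σℕ.∑-comm (λ v e → bit (lookup (δ ⁅ v ⁆) e)) ⟩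
    Σℕ.sum (λ e → Σℕ.sum (λ v → bit (lookup (δ ⁅ v ⁆) e)))
      ≤⟨ sum-mono-≤ ends ⟩
    Σℕ.sum {m} (λ _ → 2)
      ≡⟨ sum-const m ⟩
    m ℕ.* 2 ∎
    where
    open ℕ.≤-Reasoning

    sum-const : ∀ k → Σℕ.sum {k} (λ _ → 2) ≡ k ℕ.* 2
    sum-const zero    = refl
    sum-const (suc k) = cong (2 ℕ.+_) (sum-const k)

    bit-xor : ∀ a b → bit (a xor b) ℕ.≤ bit a ℕ.+ bit b
    bit-xor = from-yes (∀Bool? λ a → ∀Bool? λ b → bit (a xor b) ℕ.≤? bit a ℕ.+ bit b)

    once : ∀ u → Σℕ.sum (λ v → bit (lookup ⁅ v ⁆ u)) ≡ 1
    once u = trans (Σℕ.sum-cong-≗ λ v → cong bit (lookup-⁅⁆-comm v u))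
      (trans (sym (∣p∣≡sum ⁅ u ⁆)) (∣⁅x⁆∣≡1 u))

    ends : ∀ e → Σℕ.sum (λ v → bit (lookup (δ ⁅ v ⁆) e)) ℕ.≤ 2
    ends e = begin
      Σℕ.sum (λ v → bit (lookup (δ ⁅ v ⁆) e))
        ≤⟨ sum-mono-≤ (λ v → subst
             (λ b → bit b ℕ.≤ bit (lookup ⁅ v ⁆ (src e)) ℕ.+ bit (lookup ⁅ v ⁆ (tgt e)))
             (sym (lookup∘tabulate (λ e → lookup ⁅ v ⁆ (src e) xor lookup ⁅ v ⁆ (tgt e)) e))
             (bit-xor (lookup ⁅ v ⁆ (src e)) (lookup ⁅ v ⁆ (tgt e)))) ⟩
      Σℕ.sum (λ v → bit (lookup ⁅ v ⁆ (src e)) ℕ.+ bit (lookup ⁅ v ⁆ (tgt e)))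
        ≡⟨ Σℕ.∑-distrib-+ (λ v → bit (lookup ⁅ v ⁆ (src e))) (λ v → bit (lookup ⁅ v ⁆ (tgt e))) ⟩
      Σℕ.sum (λ v → bit (lookup ⁅ v ⁆ (src e))) ℕ.+ Σℕ.sum (λ v → bit (lookup ⁅ v ⁆ (tgt e)))
        ≡⟨ cong₂ ℕ._+_ (once (src e)) (once (tgt e)) ⟩
      2 ∎

module _ (G : SteinerGraph) (irreducible : Irreducible G) where
  open SteinerGraph G
  open Degrees graph

  -- Connectedness gives `v` a neighbour `w`. If there were no other, removing `w` would separate
  -- `v` from a terminal `u ≢ w`, and `w` would be a cut node. Degree two is excluded by
  -- irreducibility.
  nonterminal-degree : ∀ {v} → v ∉ T → 3 ℕ.≤ degree v
  nonterminal-degree {v} v∉T = ℕ.≤∧≢⇒< 2≤degree (≢-sym (proj₂ irreducible v v∉T))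
    where
    v≢ : ∀ {u} → u ∈ T → v ≢ u
    v≢ u∈T refl = v∉T u∈T

    2≤degree : 2 ℕ.≤ degree v
    2≤degree with other-element ∣T∣≥2 v
    ... | t , t∈T , _ with neighbour (v≢ t∈T) (connected v t ∈⊤ ∈⊤)
    ...   | w , _ , v~w with other-element ∣T∣≥2 w
    -- The absence of cut nodes yields only the double negation of connectedness, which suffices for
    -- a decidable goal.
    ...     | u , u∈T , u≢w = decidable-stable (2 ℕ.≤? degree v) λ 2≰ →
      proj₁ irreducible w λ conn → 2≰ (second-edge conn)
      where
      outside-w : ∀ {x} → x ≢ w → x ∈ ∁ ⁅ w ⁆
      outside-w x≢w = x∉p⇒x∈∁p (x≢y⇒x∉⁅y⁆ x≢w)

      second-edge : ConnectedOn (∁ ⁅ w ⁆) → 2 ℕ.≤ degree v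
      second-edge conn with neighbour (v≢ u∈T) (conn v u (outside-w (adjacent⇒≢ v~w)) (outside-w u≢w))
      ... | x , x∈ , v~x = 2≤∣p∣ (adjacent⇒∈δ v~w) (adjacent⇒∈δ v~x) λ same →
        x∈∁p⇒x∉p x∈ (subst (_∈ ⁅ w ⁆) (same-edge v~w v~x same) (x∈⁅x⁆ w))

  nonterminals≤ : 3 ℕ.* ∣ ∁ T ∣ ℕ.≤ m ℕ.* 2
  nonterminals≤ = begin
    3 ℕ.* ∣ ∁ T ∣                               ≡⟨ cong (3 ℕ.*_) (∣p∣≡sum (∁ T)) ⟩
    3 ℕ.* Σℕ.sum (λ v → bit (lookup (∁ T) v))   ≡⟨ Σℕ.*-distribˡ-sum 3 (λ v → bit (lookup (∁ T) v)) ⟩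
    Σℕ.sum (λ v → 3 ℕ.* bit (lookup (∁ T) v))   ≤⟨ sum-mono-≤ degree≥ ⟩
    Σℕ.sum degree                               ≤⟨ degree-sum ⟩
    m ℕ.* 2                                     ∎
    where
    open ℕ.≤-Reasoning
    degree≥ : ∀ v → 3 ℕ.* bit (lookup (∁ T) v) ℕ.≤ degree v
    degree≥ v with lookup (∁ T) v in eq
    ... | false = ℕ.z≤n
    ... | true  = nonterminal-degree (x∈∁p⇒x∉p (lookup⇒[]= v (∁ T) eq))

  -- With `k` nonterminals, `3 k ≤ 2 m ≤ 2 (k + 2 τ)`, so `k ≤ 4 τ`; the terminals add one more `τ`.
  nodes≤ : m ℕ.≤ n ℕ.+ ∣ T ∣ → n ℕ.≤ 5 ℕ.* ∣ T ∣
  nodes≤ m≤ = subst (ℕ._≤ 5 ℕ.* τ) k+τ≡n (begin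
    k ℕ.+ τ            ≤⟨ ℕ.+-monoˡ-≤ τ k≤4τ ⟩
    4 ℕ.* τ ℕ.+ τ      ≡⟨ ℕ.+-comm (4 ℕ.* τ) τ ⟩
    5 ℕ.* τ            ∎)
    where
    open ℕ.≤-Reasoning
    k = ∣ ∁ T ∣
    τ = ∣ T ∣
    k+τ≡n : k ℕ.+ τ ≡ n
    k+τ≡n = trans (cong (ℕ._+ τ) (∣∁p∣≡n∸∣p∣ T)) (ℕ.m∸n+n≡m (∣p∣≤n T))
    expand : ∀ k τ → (k ℕ.+ τ ℕ.+ τ) ℕ.* 2 ≡ 2 ℕ.* k ℕ.+ 4 ℕ.* τ
    expand = solve-∀
    split : ∀ k → 2 ℕ.* k ℕ.+ k ≡ 3 ℕ.* k
    split = solve-∀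
    k≤4τ : k ℕ.≤ 4 ℕ.* τ
    k≤4τ = ℕ.+-cancelˡ-≤ (2 ℕ.* k) k (4 ℕ.* τ) (begin
      2 ℕ.* k ℕ.+ k            ≡⟨ split k ⟩
      3 ℕ.* k                  ≤⟨ nonterminals≤ ⟩
      m ℕ.* 2                  ≤⟨ ℕ.*-monoˡ-≤ 2 m≤ ⟩
      (n ℕ.+ τ) ℕ.* 2          ≡⟨ cong (λ n → (n ℕ.+ τ) ℕ.* 2) k+τ≡n ⟨
      (k ℕ.+ τ ℕ.+ τ) ℕ.* 2    ≡⟨ expand k τ ⟩
      2 ℕ.* k ℕ.+ 4 ℕ.* τ      ∎)

-- Counting isomorphism classes

fromBool : Bool → Fin 2
fromBool false = zero
fromBool true  = suc zero

fromBool-injective : ∀ {a b} → fromBool a ≡ fromBool b → a ≡ b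
fromBool-injective {false} {false} _ = refl
fromBool-injective {true}  {true}  _ = refl

boolFun : ∀ {k} → (Fin k → Bool) → Fin (2 ℕ.^ k)
boolFun f = funToFin (λ i → fromBool (f i))

boolFun-injective : ∀ {k} {f g : Fin k → Bool} → boolFun f ≡ boolFun g → ∀ i → f i ≡ g i
boolFun-injective {f = f} {g} eq i = fromBool-injective (begin
  fromBool (f i)                      ≡⟨ Fin.finToFun-funToFin _ i ⟨
  finToFun (boolFun f) i              ≡⟨ cong (λ c → finToFun c i) eq ⟩
  finToFun (boolFun g) i              ≡⟨ Fin.finToFun-funToFin _ i ⟩
  fromBool (g i)                      ∎)
  where open ≡-Reasoning

matrix : ∀ {k} → (Fin k → Fin k → Bool) → Fin (2 ℕ.^ (k ℕ.* k))
matrix {k} A = boolFun λ p → A (proj₁ (remQuot {k} k p)) (proj₂ (remQuot {k} k p))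

matrix-injective : ∀ {k} {A B : Fin k → Fin k → Bool} → matrix A ≡ matrix B → ∀ i j → A i j ≡ B i j
matrix-injective {k} {A} {B} eq i j =
  subst (λ p → A (proj₁ p) (proj₂ p) ≡ B (proj₁ p) (proj₂ p)) (Fin.remQuot-combine {k} i j)
    (boolFun-injective {f = λ p → A (proj₁ (remQuot {k} k p)) (proj₂ (remQuot {k} k p))} eq (combine i j))

-- The factors account for the number of nodes, from 0 to `N`, the adjacency matrix and the terminal
-- set.
codes : ℕ → ℕ
codes N = suc N ℕ.* (2 ℕ.^ (N ℕ.* N) ℕ.* 2 ℕ.^ N)

code : ∀ {N k} → k ℕ.≤ N → (Fin k → Fin k → Bool) → (Fin k → Bool) → Fin (codes N)
code {N} k≤N A S = combine (fromℕ< (ℕ.s≤s k≤N))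
  (combine (inject≤ (matrix A) (ℕ.^-monoʳ-≤ 2 (ℕ.*-mono-≤ k≤N k≤N)))
           (inject≤ (boolFun S) (ℕ.^-monoʳ-≤ 2 k≤N)))

-- A code describes a labelled graph: equal codes force equal sizes, and then the identity is the
-- bijection.
code-injective : ∀ {N k l} (k≤N : k ℕ.≤ N) (l≤N : l ℕ.≤ N) A S B U →
  code k≤N A S ≡ code l≤N B U →
  Σ (Fin k ↔ Fin l) λ f → let to = Inverse.to f in
    (∀ i j → A i j ≡ B (to i) (to j)) × (∀ i → S i ≡ U (to i))
code-injective {N} {k} {l} k≤N l≤N A S B U eq
  with Fin.combine-injective {suc N} {2 ℕ.^ (N ℕ.* N) ℕ.* 2 ℕ.^ N} _ _ _ _ eq
... | size , rest with k≡l
  where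
  k≡l : k ≡ l
  k≡l = trans (sym (Fin.toℕ-fromℕ< (ℕ.s≤s k≤N))) (trans (cong toℕ size) (Fin.toℕ-fromℕ< (ℕ.s≤s l≤N)))
... | refl with Fin.combine-injective {2 ℕ.^ (N ℕ.* N)} {2 ℕ.^ N} _ _ _ _ rest
...   | eqA , eqS = ↔-id (Fin k)
  , matrix-injective {A = A} {B} (Fin.inject≤-injective _ _ _ _ eqA)
  , boolFun-injective {f = S} {U} (Fin.inject≤-injective _ _ _ _ eqS)

module _ (G : Graph) where
  open Graph G

  adjacent? : ∀ u v → Dec (Adjacent u v)
  adjacent? u v = Fin.any? λ e →
    (src e Fin.≟ u ×-dec tgt e Fin.≟ v) ⊎-dec (src e Fin.≟ v ×-dec tgt e Fin.≟ u)

  adjacency : V → V → Bool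
  adjacency u v = does (adjacent? u v)

-- The numbering of the edges is forgotten, in accordance with `_≅_`, which sees only adjacency and
-- terminals.
steinerCode : ∀ {N} (G : SteinerGraph) → SteinerGraph.n G ℕ.≤ N → Fin (codes N)
steinerCode G n≤N = code n≤N (adjacency graph) (lookup T)
  where open SteinerGraph G

does-⇔ : ∀ {P Q : Set} (P? : Dec P) (Q? : Dec Q) → does P? ≡ does Q? → P ⇔ Q
does-⇔ (yes p) (yes q) _ = mk⇔ (λ _ → q) (λ _ → p)
does-⇔ (no ¬p) (no ¬q) _ = mk⇔ (λ p → contradiction p ¬p) (λ q → contradiction q ¬q)

steinerCode-injective : ∀ {N} (G H : SteinerGraph) (g : SteinerGraph.n G ℕ.≤ N)
  (h : SteinerGraph.n H ℕ.≤ N) → steinerCode G g ≡ steinerCode H h → G ≅ H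
steinerCode-injective G H g h eq
  with code-injective g h (adjacency (SteinerGraph.graph G)) (lookup (SteinerGraph.T G))
                          (adjacency (SteinerGraph.graph H)) (lookup (SteinerGraph.T H)) eq
... | f , adj , term = record
  { bijection = f
  ; adjacent  = λ u v → does-⇔ (adjacent? G.graph u v) (adjacent? H.graph (to u) (to v)) (adj u v)
  ; terminal  = λ u → mk⇔ (λ u∈ → lookup⇒[]= (to u) H.T (trans (sym (term u)) ([]=⇒lookup u∈)))
                          (λ u∈ → lookup⇒[]= u G.T (trans (term u) ([]=⇒lookup u∈)))
  }
  where
  module G = SteinerGraph G
  module H = SteinerGraph H
  open Inverse f using (to)

AllPairs-lookup : ∀ {A : Set} {R : A → A → Set} {xs : List A} → AllPairs R xs →
                  ∀ {i j} → i Fin.< j → R (List.lookup xs i) (List.lookup xs j)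
AllPairs-lookup (r ∷ _) {zero}  {suc j} _         = All.lookup r (∈-lookup j)
AllPairs-lookup (_ ∷ p) {suc i} {suc j} (ℕ.s≤s i<j) = AllPairs-lookup p i<j

≇-length≤ : ∀ N (Gs : List SteinerGraph) → All (λ G → SteinerGraph.n G ℕ.≤ N) Gs →
            AllPairs (λ G H → ¬ (G ≅ H)) Gs → length Gs ℕ.≤ codes N
≇-length≤ N Gs small distinct = ℕ.≮⇒≥ λ many →
  let i , j , i<j , same = Fin.pigeonhole many λ i → steinerCode (List.lookup Gs i) (n≤N i)
  in AllPairs-lookup distinct i<j
       (steinerCode-injective (List.lookup Gs i) (List.lookup Gs j) (n≤N i) (n≤N j) same)
  where
  n≤N : ∀ i → SteinerGraph.n (List.lookup Gs i) ℕ.≤ N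
  n≤N i = All.lookup small (∈-lookup i)

-- The ordered ring of real numbers

module Reals where

  open Defs using (_+_; _*_; _≤_; _≃_)

  Eventually : (ℕ → Set) → Set
  Eventually P = ∃[ N ] (∀ n → N ℕ.≤ n → P n)

  eventually-map₂ : ∀ {P Q R : ℕ → Set} → (∀ n → P n → Q n → R n) →
                    Eventually P → Eventually Q → Eventually R
  eventually-map₂ f (M , p) (N , q) = M ℕ.⊔ N , λ n n≥ →
    f n (p n (ℕ.m⊔n≤o⇒m≤o M N n≥)) (q n (ℕ.m⊔n≤o⇒n≤o M N n≥))

  eventually-inhabited : ∀ {P : ℕ → Set} → Eventually P → ∃ P
  eventually-inhabited (N , p) = N , p N ℕ.≤-refl

  Null : (ℕ → ℚ) → Set
  Null z = ∀ ε → 0ℚ ℚ.< ε → Eventually (λ n → ℚ.∣ z n ∣ ℚ.< ε)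

  Apart : (ℕ → ℚ) → Set
  Apart z = ∃[ η ] (0ℚ ℚ.< η × Eventually (λ n → η ℚ.≤ ℚ.∣ z n ∣))

  half : ∀ {ε} → 0ℚ ℚ.< ε → 0ℚ ℚ.< ½ ℚ.* ε
  half {ε} 0<ε = subst (ℚ._< ½ ℚ.* ε) (ℚ.*-zeroʳ ½) (ℚ.*-monoʳ-<-pos ½ 0<ε)

  half+half : ∀ ε → ½ ℚ.* ε ℚ.+ ½ ℚ.* ε ≡ ε
  half+half ε = trans (sym (ℚ.*-distribʳ-+ ε ½ ½)) (ℚ.*-identityˡ ε)

  p≤∣p∣ : ∀ p → p ℚ.≤ ℚ.∣ p ∣
  p≤∣p∣ p with ℚ.≤-total 0ℚ p
  ... | inj₁ 0≤p = ℚ.≤-reflexive (sym (ℚ.0≤p⇒∣p∣≡p 0≤p))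
  ... | inj₂ p≤0 = ℚ.≤-trans p≤0 (ℚ.0≤∣p∣ p)

  ∣p∣≤∣p-q∣+∣q∣ : ∀ p q → ℚ.∣ p ∣ ℚ.≤ ℚ.∣ p ℚ.- q ∣ ℚ.+ ℚ.∣ q ∣
  ∣p∣≤∣p-q∣+∣q∣ p q = subst (λ r → ℚ.∣ r ∣ ℚ.≤ ℚ.∣ p ℚ.- q ∣ ℚ.+ ℚ.∣ q ∣)
    (solve 2 (λ p q → (p :- q) :+ q := p) refl p q) (ℚ.∣p+q∣≤∣p∣+∣q∣ (p ℚ.- q) q)
    where open +-*-Solver

  null-cong : ∀ {y z} → (∀ n → y n ≡ z n) → Null y → Null z
  null-cong y≗z y0 ε 0<ε with y0 ε 0<ε
  ... | N , h = N , λ n n≥ → subst (λ q → ℚ.∣ q ∣ ℚ.< ε) (y≗z n) (h n n≥)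

  null-+ : ∀ {y z} → Null y → Null z → Null (λ n → y n ℚ.+ z n)
  null-+ {y} {z} y0 z0 ε 0<ε = eventually-map₂
    (λ n hy hz → ℚ.≤-<-trans (ℚ.∣p+q∣≤∣p∣+∣q∣ (y n) (z n))
       (subst (_ ℚ.<_) (half+half ε) (ℚ.+-mono-< hy hz)))
    (y0 _ (half 0<ε)) (z0 _ (half 0<ε))

  null-neg : ∀ {y} → Null y → Null (λ n → ℚ.- y n)
  null-neg {y} y0 ε 0<ε with y0 ε 0<ε
  ... | N , h = N , λ n n≥ → subst (ℚ._< ε) (sym (ℚ.∣-p∣≡∣p∣ (y n))) (h n n≥)

  bounded : (x : ℝ) → ∃[ B ] (0ℚ ℚ.< B × Eventually (λ n → ℚ.∣ seq x n ∣ ℚ.≤ B))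
  bounded x with cauchy x 1ℚ (ℚ.positive⁻¹ 1ℚ)
  ... | N , h = 1ℚ ℚ.+ ℚ.∣ seq x N ∣
    , ℚ.+-mono-<-≤ (ℚ.positive⁻¹ 1ℚ) (ℚ.0≤∣p∣ (seq x N))
    , N , λ n n≥ → ℚ.≤-trans (∣p∣≤∣p-q∣+∣q∣ (seq x n) (seq x N))
        (ℚ.+-monoˡ-≤ ℚ.∣ seq x N ∣ (ℚ.<⇒≤ (h n N n≥ ℕ.≤-refl)))

  divide : ∀ B η → 0ℚ ℚ.< B → 0ℚ ℚ.< η → ∃[ θ ] (0ℚ ℚ.< θ × B ℚ.* θ ≡ η)
  divide B η 0<B 0<η = ℚ.1/ B ℚ.* η , ℚ.positive⁻¹ _ ,
    trans (sym (ℚ.*-assoc B (ℚ.1/ B) η))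
      (trans (cong (ℚ._* η) (ℚ.*-inverseʳ B)) (ℚ.*-identityˡ η))
    where
    instance
      B>0 : ℚ.Positive B
      B>0 = ℚ.positive 0<B
      η>0 : ℚ.Positive η
      η>0 = ℚ.positive 0<η
      B≢0 : ℚ.NonZero B
      B≢0 = ℚ.pos⇒nonZero B
      1/B>0 : ℚ.Positive (ℚ.1/ B)
      1/B>0 = ℚ.1/pos⇒pos B
      quotient>0 : ℚ.Positive (ℚ.1/ B ℚ.* η)
      quotient>0 = ℚ.pos*pos⇒pos (ℚ.1/ B) η

  null-* : ∀ x {z} → Null z → Null (λ n → seq x n ℚ.* z n)
  null-* x {z} z0 ε 0<ε =
    let B , 0<B , x≤B = bounded x
        θ , 0<θ , Bθ≡ε = divide B ε 0<B 0<ε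
    in eventually-map₂
         (λ n xn≤B zn<θ → subst (_ ℚ.<_) Bθ≡ε (subst (ℚ._< B ℚ.* θ)
            (sym (ℚ.∣p*q∣≡∣p∣*∣q∣ (seq x n) (z n)))
            (ℚ.≤-<-trans
              (ℚ.*-monoʳ-≤-nonNeg ℚ.∣ z n ∣ ⦃ ℚ.nonNegative (ℚ.0≤∣p∣ (z n)) ⦄ xn≤B)
              (ℚ.*-monoʳ-<-pos B ⦃ ℚ.positive 0<B ⦄ zn<θ))))
         x≤B (z0 θ 0<θ)

  -- Cauchy sequences have a term close to all later ones, and the size of that
  -- term is decidable.
  small-or-apart : ∀ {z} → Cauchy z → ∀ {ε} → 0ℚ ℚ.< ε →
                   Eventually (λ n → ℚ.∣ z n ∣ ℚ.< ε) ⊎ Apart z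
  -- The tail stays within `ε/4` of term `N`, whose size is compared with `ε/2`: if smaller, the
  -- tail stays below `ε`; if not, at or above `ε/4`.
  small-or-apart {z} cz {ε} 0<ε with cz (½ ℚ.* (½ ℚ.* ε)) (half (half 0<ε))
  ... | N , h with ℚ.∣ z N ∣ ℚ.<? ½ ℚ.* ε
  ...   | yes zN<½ε = inj₁ (N , λ n n≥ → ℚ.≤-<-trans (∣p∣≤∣p-q∣+∣q∣ (z n) (z N))
            (subst (_ ℚ.<_) (half+half ε)
              (ℚ.+-mono-< (ℚ.<-trans (h n N n≥ ℕ.≤-refl) quarter<half) zN<½ε)))
    where
    quarter<half : ½ ℚ.* (½ ℚ.* ε) ℚ.< ½ ℚ.* ε
    quarter<half = subst₂ ℚ._<_ (ℚ.+-identityʳ _) (half+half (½ ℚ.* ε))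
      (ℚ.+-monoʳ-< (½ ℚ.* (½ ℚ.* ε)) (half (half 0<ε)))
  ...   | no zN≮½ε = inj₂ (½ ℚ.* (½ ℚ.* ε) , half (half 0<ε) , N , λ n n≥ →
            ℚ.≮⇒≥ λ zn<¼ε → zN≮½ε (ℚ.≤-<-trans (∣p∣≤∣p-q∣+∣q∣ (z N) (z n))
              (subst (_ ℚ.<_) (half+half (½ ℚ.* ε))
                (ℚ.+-mono-< (h N n ℕ.≤-refl n≥) zn<¼ε))))

  apart⇒¬null : ∀ {z} → Apart z → ¬ Null z
  apart⇒¬null (η , 0<η , far) z0
    with eventually-inhabited (eventually-map₂ (λ _ → _,_) far (z0 η 0<η))
  ... | _ , η≤ , <η = ℚ.<-irrefl refl (ℚ.≤-<-trans η≤ <η)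

  -- Each `ε` is settled separately by the dichotomy, whose second branch refutes `Null`.
  null-stable : ∀ {z} → Cauchy z → ¬ ¬ Null z → Null z
  null-stable {z} cz ¬¬z0 ε 0<ε with small-or-apart {z} cz 0<ε
  ... | inj₁ small = small
  ... | inj₂ apart = contradiction (apart⇒¬null {z} apart) ¬¬z0

  apart-* : ∀ {y z} → Apart y → Apart z → Apart (λ n → y n ℚ.* z n)
  apart-* {y} {z} (η , 0<η , y≥) (θ , 0<θ , z≥) = η ℚ.* θ , ℚ.positive⁻¹ _ ,
    eventually-map₂ (λ n η≤ θ≤ → subst (η ℚ.* θ ℚ.≤_) (sym (ℚ.∣p*q∣≡∣p∣*∣q∣ (y n) (z n)))
      (ℚ.≤-trans (ℚ.*-monoʳ-≤-nonNeg θ ⦃ ℚ.pos⇒nonNeg θ ⦄ η≤)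
        (ℚ.*-monoˡ-≤-nonNeg ℚ.∣ y n ∣ ⦃ ℚ.nonNegative (ℚ.0≤∣p∣ (y n)) ⦄ θ≤)))
      y≥ z≥
    where
    instance
      η>0 : ℚ.Positive η
      η>0 = ℚ.positive 0<η
      θ>0 : ℚ.Positive θ
      θ>0 = ℚ.positive 0<θ
      ηθ>0 : ℚ.Positive (η ℚ.* θ)
      ηθ>0 = ℚ.pos*pos⇒pos η θ

  infix 4 _≈_
  infix 8 -_

  -- A record, so that both sides can be inferred by unification.
  record _≈_ (x y : ℝ) : Set where
    constructor wrap
    field
      unwrap : x ≃ y

  open _≈_ public

  pointwise : ∀ x y → (∀ n → seq x n ≡ seq y n) → x ≈ y
  pointwise x y x≗y = wrap ((λ ε 0<ε → 0 , λ n _ →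
    subst (λ q → ℚ.∣ q ∣ ℚ.< ε)
      (sym (trans (cong (ℚ._- seq y n) (x≗y n)) (ℚ.+-inverseʳ (seq y n)))) 0<ε))

  abstract
    neg-cauchy : ∀ {z} → Cauchy z → Cauchy (λ n → ℚ.- z n)
    neg-cauchy {z} cz ε 0<ε = let N , h = cz ε 0<ε in N , λ m n m≥ n≥ →
      subst (ℚ._< ε) (trans (sym (ℚ.∣-p∣≡∣p∣ _)) (cong ℚ.∣_∣ (neg-minus (z m) (z n))))
        (h m n m≥ n≥)
      where
      open +-*-Solver
      neg-minus : ∀ p q → ℚ.- (p ℚ.- q) ≡ ℚ.- p ℚ.- ℚ.- q
      neg-minus = solve 2 (λ p q → :- (p :- q) := :- p :- :- q) refl

  -_ : ℝ → ℝ
  - x = record { seq = λ n → ℚ.- seq x n ; cauchy = neg-cauchy {seq x} (cauchy x) }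

  ≈-sym : ∀ {x y} → x ≈ y → y ≈ x
  ≈-sym {x} {y} (wrap e) = wrap (null-cong (λ n → neg-minus (seq x n) (seq y n)) (null-neg e))
    where
    open +-*-Solver
    neg-minus : ∀ p q → ℚ.- (p ℚ.- q) ≡ q ℚ.- p
    neg-minus = solve 2 (λ p q → :- (p :- q) := q :- p) refl

  ≈-trans : ∀ {x y z} → x ≈ y → y ≈ z → x ≈ z
  ≈-trans {x} {y} {z} (wrap e) (wrap f) =
    wrap (null-cong (λ n → telescope (seq x n) (seq y n) (seq z n)) (null-+ e f))
    where
    open +-*-Solver
    telescope : ∀ p q r → (p ℚ.- q) ℚ.+ (q ℚ.- r) ≡ p ℚ.- r
    telescope = solve 3 (λ p q r → (p :- q) :+ (q :- r) := p :- r) refl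

  +-cong : ∀ {x y u v} → x ≈ y → u ≈ v → x + u ≈ y + v
  +-cong {x} {y} {u} {v} (wrap e) (wrap f) =
    wrap (null-cong (λ n → regroup (seq x n) (seq y n) (seq u n) (seq v n)) (null-+ e f))
    where
    open +-*-Solver
    regroup : ∀ p q r s → (p ℚ.- q) ℚ.+ (r ℚ.- s) ≡ (p ℚ.+ r) ℚ.- (q ℚ.+ s)
    regroup = solve 4 (λ p q r s → (p :- q) :+ (r :- s) := (p :+ r) :- (q :+ s)) refl

  *-cong : ∀ {x y u v} → x ≈ y → u ≈ v → x * u ≈ y * v
  *-cong {x} {y} {u} {v} (wrap e) (wrap f) =
    wrap (null-cong (λ n → regroup (seq x n) (seq y n) (seq u n) (seq v n))
        (null-+ (null-* x f) (null-* v e)))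
    where
    open +-*-Solver
    regroup : ∀ p q r s → p ℚ.* (r ℚ.- s) ℚ.+ s ℚ.* (p ℚ.- q) ≡ p ℚ.* r ℚ.- q ℚ.* s
    regroup = solve 4 (λ p q r s → p :* (r :- s) :+ s :* (p :- q) := p :* r :- q :* s) refl

  neg-cong : ∀ {x y} → x ≈ y → - x ≈ - y
  neg-cong {x} {y} (wrap e) = wrap (null-cong (λ n → neg-minus (seq x n) (seq y n)) (null-neg e))
    where
    open +-*-Solver
    neg-minus : ∀ p q → ℚ.- (p ℚ.- q) ≡ ℚ.- p ℚ.- ℚ.- q
    neg-minus = solve 2 (λ p q → :- (p :- q) := :- p :- :- q) refl

  ≈-isEquivalence : IsEquivalence _≈_
  ≈-isEquivalence = record
    { refl = λ {x} → pointwise x x λ _ → refl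
    ; sym = λ {x} {y} → ≈-sym {x} {y} ; trans = λ {x} {y} {z} → ≈-trans {x} {y} {z} }

  +-assoc : ∀ x y z → x + y + z ≈ x + (y + z)
  +-assoc x y z = pointwise (x + y + z) (x + (y + z)) λ n → ℚ.+-assoc (seq x n) (seq y n) (seq z n)

  +-comm : ∀ x y → x + y ≈ y + x
  +-comm x y = pointwise (x + y) (y + x) λ n → ℚ.+-comm (seq x n) (seq y n)

  +-identityˡ : ∀ x → 0ℝ + x ≈ x
  +-identityˡ x = pointwise (0ℝ + x) x λ n → ℚ.+-identityˡ (seq x n)

  +-identityʳ : ∀ x → x + 0ℝ ≈ x
  +-identityʳ x = pointwise (x + 0ℝ) x λ n → ℚ.+-identityʳ (seq x n)

  +-inverseˡ : ∀ x → - x + x ≈ 0ℝ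
  +-inverseˡ x = pointwise (- x + x) 0ℝ λ n → ℚ.+-inverseˡ (seq x n)

  +-inverseʳ : ∀ x → x + - x ≈ 0ℝ
  +-inverseʳ x = pointwise (x + - x) 0ℝ λ n → ℚ.+-inverseʳ (seq x n)

  *-assoc : ∀ x y z → x * y * z ≈ x * (y * z)
  *-assoc x y z = pointwise (x * y * z) (x * (y * z)) λ n → ℚ.*-assoc (seq x n) (seq y n) (seq z n)

  *-comm : ∀ x y → x * y ≈ y * x
  *-comm x y = pointwise (x * y) (y * x) λ n → ℚ.*-comm (seq x n) (seq y n)

  *-identityˡ : ∀ x → 1ℝ * x ≈ x
  *-identityˡ x = pointwise (1ℝ * x) x λ n → ℚ.*-identityˡ (seq x n)

  *-identityʳ : ∀ x → x * 1ℝ ≈ x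
  *-identityʳ x = pointwise (x * 1ℝ) x λ n → ℚ.*-identityʳ (seq x n)

  *-distribˡ-+ : ∀ x y z → x * (y + z) ≈ x * y + x * z
  *-distribˡ-+ x y z = pointwise (x * (y + z)) (x * y + x * z)
    λ n → ℚ.*-distribˡ-+ (seq x n) (seq y n) (seq z n)

  *-distribʳ-+ : ∀ x y z → (y + z) * x ≈ y * x + z * x
  *-distribʳ-+ x y z = pointwise ((y + z) * x) (y * x + z * x)
    λ n → ℚ.*-distribʳ-+ (seq x n) (seq y n) (seq z n)

  ℝ-commutativeRing : CommutativeRing 0ℓ 0ℓ
  ℝ-commutativeRing = record
    { Carrier = ℝ ; _≈_ = _≈_ ; _+_ = _+_ ; _*_ = _*_ ; -_ = -_ ; 0# = 0ℝ ; 1# = 1ℝ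
    ; isCommutativeRing = record
      { isRing = record
        { +-isAbelianGroup = record
          { isGroup = record
            { isMonoid = record
              { isSemigroup = record
                { isMagma = record
                  { isEquivalence = ≈-isEquivalence
                  ; ∙-cong = λ {x} {y} {u} {v} → +-cong {x} {y} {u} {v}
                  }
                ; assoc = +-assoc
                }
              ; identity = +-identityˡ , +-identityʳ
              }
            ; inverse = +-inverseˡ , +-inverseʳ
            ; ⁻¹-cong = λ {x} {y} → neg-cong {x} {y}
            }
          ; comm = +-comm
          }
        ; *-cong = λ {x} {y} {u} {v} → *-cong {x} {y} {u} {v}
        ; *-assoc = *-assoc
        ; *-identity = *-identityˡ , *-identityʳ
        ; distrib = *-distribˡ-+ , *-distribʳ-+
        }
      ; *-comm = *-comm
      }
    }

  ≈0⇒null : ∀ {x} → x ≈ 0ℝ → Null (seq x)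
  ≈0⇒null {x} (wrap e) = null-cong (λ n → ℚ.+-identityʳ (seq x n)) e

  null⇒≈0 : ∀ {x} → Null (seq x) → x ≈ 0ℝ
  null⇒≈0 {x} z = wrap (null-cong (λ n → sym (ℚ.+-identityʳ (seq x n))) z)

  ≈-stable : ∀ {x y} → ¬ ¬ (x ≈ y) → x ≈ y
  ≈-stable {x} {y} ¬¬e = wrap (null-stable {seq (x + - y)} (cauchy (x + - y))
    (λ ¬e → ¬¬e λ e → ¬e (unwrap e)))

  -- If the dichotomy for `y` returns apartness, the one for `x` cannot, since the product would
  -- then be apart from zero; so `x` would be null, against the hypothesis.
  *-cancel-≈0 : ∀ {x y} → ¬ (x ≈ 0ℝ) → x * y ≈ 0ℝ → y ≈ 0ℝ
  *-cancel-≈0 {x} {y} x≉0 xy≈0 = null⇒≈0 λ ε 0<ε → small 0<ε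
    where
    small : ∀ {ε} → 0ℚ ℚ.< ε → Eventually (λ n → ℚ.∣ seq y n ∣ ℚ.< ε)
    small 0<ε with small-or-apart {seq y} (cauchy y) 0<ε
    ... | inj₁ s = s
    ... | inj₂ y# = contradiction (null⇒≈0 λ η 0<η → small′ 0<η) x≉0
      where
      small′ : ∀ {η} → 0ℚ ℚ.< η → Eventually (λ n → ℚ.∣ seq x n ∣ ℚ.< η)
      small′ 0<η with small-or-apart {seq x} (cauchy x) 0<η
      ... | inj₁ s = s
      ... | inj₂ x# = contradiction (≈0⇒null xy≈0) (apart⇒¬null (apart-* x# y#))

  infix 4 0≤_

  record 0≤_ (x : ℝ) : Set where
    constructor nonNeg
    field
      unwrap≤ : 0ℝ ≤ x

  0≤-resp-≈ : ∀ {x y} → x ≈ y → 0≤ x → 0≤ y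
  0≤-resp-≈ {x} {y} (wrap e) (nonNeg 0≤x) = nonNeg λ ε 0<ε → eventually-map₂
    (λ n x> x-y< → subst (λ θ → 0ℚ ℚ.< seq y n ℚ.+ θ) (half+half ε)
       (transfer (seq x n) (seq y n) x> x-y<))
    (0≤x _ (half 0<ε)) (e _ (half 0<ε))
    where
    open +-*-Solver
    transfer : ∀ p q {θ} → 0ℚ ℚ.< p ℚ.+ θ → ℚ.∣ p ℚ.- q ∣ ℚ.< θ → 0ℚ ℚ.< q ℚ.+ (θ ℚ.+ θ)
    transfer p q {θ} 0<p+θ p-q<θ = ℚ.<-trans 0<p+θ (subst₂ ℚ._<_
      (solve 3 (λ p q θ → (p :- q) :+ (q :+ θ) := p :+ θ) refl p q θ)
      (solve 2 (λ q θ → θ :+ (q :+ θ) := q :+ (θ :+ θ)) refl q θ)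
      (ℚ.+-monoˡ-< (q ℚ.+ θ) (ℚ.≤-<-trans (p≤∣p∣ (p ℚ.- q)) p-q<θ)))

  0≤-+ : ∀ {x y} → 0≤ x → 0≤ y → 0≤ x + y
  0≤-+ {x} {y} (nonNeg 0≤x) (nonNeg 0≤y) = nonNeg λ ε 0<ε → eventually-map₂
    (λ n x> y> → subst (0ℚ ℚ.<_)
       (trans (regroup (seq x n) (seq y n) (½ ℚ.* ε))
              (cong (seq x n ℚ.+ seq y n ℚ.+_) (half+half ε)))
       (ℚ.+-mono-< x> y>))
    (0≤x _ (half 0<ε)) (0≤y _ (half 0<ε))
    where
    open +-*-Solver
    regroup : ∀ p q θ → (p ℚ.+ θ) ℚ.+ (q ℚ.+ θ) ≡ p ℚ.+ q ℚ.+ (θ ℚ.+ θ)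
    regroup = solve 3 (λ p q θ → (p :+ θ) :+ (q :+ θ) := p :+ q :+ (θ :+ θ)) refl

  0≤-fromℚ : ∀ {q} → 0ℚ ℚ.≤ q → 0≤ fromℚ q
  0≤-fromℚ {q} 0≤q = nonNeg λ ε 0<ε → 0 , λ _ _ → ℚ.+-mono-≤-< 0≤q 0<ε

  0≤-sum-zero : ∀ {x y} → 0≤ x → 0≤ y → x + y ≈ 0ℝ → x ≈ 0ℝ
  0≤-sum-zero {x} {y} (nonNeg 0≤x) (nonNeg 0≤y) e = null⇒≈0 λ ε 0<ε → eventually-map₂
    (λ n (x> , y>) x+y< → subst (_ ℚ.<_) (half+half ε)
       (squeeze (seq x n) (seq y n) (half 0<ε) x> y> x+y<))
    (eventually-map₂ (λ _ → _,_) (0≤x _ (half 0<ε)) (0≤y _ (half 0<ε)))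
    (≈0⇒null e _ (half 0<ε))
    where
    open +-*-Solver
    -- The upper bound `p < 2 θ` comes from `p + q < θ` and `− q < θ`, the lower one from `− p < θ`;
    -- hence the slack `ε/2`.
    squeeze : ∀ p q {θ} → 0ℚ ℚ.< θ → 0ℚ ℚ.< p ℚ.+ θ → 0ℚ ℚ.< q ℚ.+ θ →
              ℚ.∣ p ℚ.+ q ∣ ℚ.< θ → ℚ.∣ p ∣ ℚ.< θ ℚ.+ θ
    squeeze p q {θ} 0<θ 0<p+θ 0<q+θ p+q<θ with ℚ.≤-total 0ℚ p
    ... | inj₁ 0≤p = subst (ℚ._< θ ℚ.+ θ) (sym (ℚ.0≤p⇒∣p∣≡p 0≤p))
      (ℚ.<-≤-trans (subst₂ ℚ._<_ (ℚ.+-identityʳ p)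
          (solve 3 (λ p q θ → p :+ (q :+ θ) := (p :+ q) :+ θ) refl p q θ)
          (ℚ.+-monoʳ-< p 0<q+θ))
        (ℚ.+-monoˡ-≤ θ (ℚ.≤-trans (p≤∣p∣ (p ℚ.+ q)) (ℚ.<⇒≤ p+q<θ))))
    ... | inj₂ p≤0 = subst (ℚ._< θ ℚ.+ θ)
      (trans (sym (ℚ.0≤p⇒∣p∣≡p (ℚ.neg-antimono-≤ p≤0))) (ℚ.∣-p∣≡∣p∣ p))
      (subst₂ ℚ._<_ (ℚ.+-identityʳ (ℚ.- p))
        (solve 2 (λ p θ → :- p :+ ((p :+ θ) :+ θ) := θ :+ θ) refl p θ)
        (ℚ.+-monoʳ-< (ℚ.- p) (ℚ.+-mono-< 0<p+θ 0<θ)))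

  -- Reduction to lowest terms does not compute for a variable `k`, so the identity is checked on
  -- unnormalised fractions.
  fromℕ-suc : ∀ k → fromℕ (suc k) ≈ 1ℝ + fromℕ k
  fromℕ-suc k = pointwise (fromℕ (suc k)) (1ℝ + fromℕ k) λ _ → ℚ.toℚᵘ-injective (begin
    ℚ.toℚᵘ (ℚ.fromℚᵘ (ℚᵘ.mkℚᵘ (+ suc k) 0))
      ≈⟨ ℚ.toℚᵘ-fromℚᵘ (ℚᵘ.mkℚᵘ (+ suc k) 0) ⟩
    ℚᵘ.mkℚᵘ (+ suc k) 0
      ≡⟨ cong (λ z → ℚᵘ.mkℚᵘ z 0) (sym (cong₂ ℤ._+_ {+ 1} refl (ℤ.*-identityʳ (+ k)))) ⟩
    ℚᵘ.1ℚᵘ ℚᵘ.+ ℚᵘ.mkℚᵘ (+ k) 0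
      ≈⟨ ℚᵘ.+-congʳ ℚᵘ.1ℚᵘ (ℚ.toℚᵘ-fromℚᵘ (ℚᵘ.mkℚᵘ (+ k) 0)) ⟨
    ℚᵘ.1ℚᵘ ℚᵘ.+ ℚ.toℚᵘ (+ k ℚ./ 1)
      ≈⟨ ℚ.toℚᵘ-homo-+ 1ℚ (+ k ℚ./ 1) ⟨
    ℚ.toℚᵘ (1ℚ ℚ.+ + k ℚ./ 1) ∎)
    where
    open import Relation.Binary.Reasoning.Setoid ℚᵘ.≃-setoid

-- Facets of the cut dominant

open Reals

1≉0 : ¬ (1ℝ ≈ 0ℝ)
1≉0 1≈0 with ≈0⇒null 1≈0 ℚ.1ℚ (ℚ.positive⁻¹ ℚ.1ℚ)
... | N , h = ℚ.<-irrefl refl (h N ℕ.≤-refl)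

0≤fromℕ : ∀ k → 0≤ fromℕ k
0≤fromℕ k = 0≤-fromℚ (ℚ.nonNegative⁻¹ (+ k ℚ./ 1) ⦃ ℚ.normalize-nonNeg k 1 ⦄)

ℝ-domain : StableDomain
ℝ-domain = record
  { commutativeRing = ℝ-commutativeRing
  ; ≈-stable = λ {x} {y} → ≈-stable {x} {y}
  ; *-cancel-≈0 = λ {x} {y} → *-cancel-≈0 {x} {y}
  ; 1≉0 = 1≉0
  }

ℝ-orderedDomain : OrderedDomain
ℝ-orderedDomain = record
  { domain = ℝ-domain
  ; 0≤_ = 0≤_
  ; 0≤-resp-≈ = λ {x} {y} → 0≤-resp-≈ {x} {y}
  ; 0≤-+ = λ {x} {y} → 0≤-+ {x} {y}
  ; +-tight = λ {x} {y} → 0≤-sum-zero {x} {y}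
  ; ⌜_⌝ = fromℕ
  ; 0≤⌜⌝ = 0≤fromℕ
  ; ⌜0⌝ = ≈-refl 0ℝ
  ; ⌜1⌝ = ≈-refl 1ℝ
  ; ⌜suc⌝ = fromℕ-suc
  }
  where
  ≈-refl : ∀ x → x ≈ x
  ≈-refl x = pointwise x x λ _ → refl

open LinearAlgebra ℝ-domain
open OrderedAlgebra ℝ-orderedDomain
module R = OrderedDomain ℝ-orderedDomain

χ≡fromℕ : ∀ {m} (F : Subset m) e → χ F e ≡ fromℕ (bit (lookup F e))
χ≡fromℕ F e with lookup F e
... | true  = refl
... | false = refl

fromℕ-sum : ∀ {m} (f : Vector ℕ m) → fromℕ (foldr ℕ._+_ 0 f) ≈ sum (λ i → fromℕ (f i))
fromℕ-sum {zero}  f = R.refl {0ℝ}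
fromℕ-sum {suc m} f = R.trans {fromℕ (f zero ℕ.+ _)} (⌜+⌝ (f zero) _)
  (R.+-congˡ {fromℕ (f zero)} (fromℕ-sum (λ i → f (suc i))))

dot-χ : ∀ {m} (c : Vector ℕ m) F → dot c (χ F) ≈ fromℕ (weight c F)
dot-χ c F = R.trans {dot c (χ F)} {sum (λ e → fromℕ (if lookup F e then c e else 0))}
  (sum-cong-≋ (λ e → pick (c e) (lookup F e)))
  (R.sym {fromℕ (weight c F)} (fromℕ-sum (λ e → if lookup F e then c e else 0)))
  where
  pick : ∀ k b → fromℕ k Defs.* (if b then 1ℝ else 0ℝ) ≈ fromℕ (if b then k else 0)
  pick k true  = R.*-identityʳ (fromℕ k)
  pick k false = R.zeroʳ (fromℕ k)

χ-balance : ∀ {m} (F G H K : Subset m) →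
  (∀ e → bit (lookup F e) ℕ.+ bit (lookup G e) ≡ bit (lookup H e) ℕ.+ bit (lookup K e)) →
  ∀ e → χ F e Defs.+ χ G e ≈ χ H e Defs.+ χ K e
χ-balance F G H K bal e = R.trans (homo F G) (R.trans (R.reflexive (cong fromℕ (bal e))) (R.sym (homo H K)))
  where
  homo : ∀ A B → χ A e Defs.+ χ B e ≈ fromℕ (bit (lookup A e) ℕ.+ bit (lookup B e))
  homo A B = subst₂ (λ x y → x Defs.+ y ≈ fromℕ (bit (lookup A e) ℕ.+ bit (lookup B e)))
    (sym (χ≡fromℕ A e)) (sym (χ≡fromℕ B e)) (R.sym (⌜+⌝ (bit (lookup A e)) (bit (lookup B e))))

module _ (G : SteinerGraph) where
  open SteinerGraph G

  steinerCut+nonNeg : ∀ {F} → SteinerCut G F → (r : Vector ℝ m) → (∀ e → 0≤ r e) →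
                      CUT₊ G (λ e → χ F e Defs.+ r e)
  steinerCut+nonNeg {F} cut r 0≤r = χ F , r , conv , (λ e → 0≤_.unwrap≤ (0≤r e)) ,
    λ e → unwrap (R.refl {χ F e Defs.+ r e})
    where
    conv : Conv (λ p → ∃[ F ] (SteinerCut G F × (∀ e → p e Defs.≃ χ F e))) (χ F)
    conv = 1 , (λ _ → χ F) , (λ _ → 1ℝ) ,
      (λ _ → F , cut , λ e → unwrap (R.refl {χ F e})) ,
      (λ _ → 0≤_.unwrap≤ 0≤1) ,
      unwrap (R.+-identityʳ 1ℝ) ,
      λ e → unwrap (R.sym (R.trans (R.+-identityʳ (1ℝ Defs.* χ F e)) (R.*-identityˡ (χ F e))))

  -- The dominant contains a translate of the nonnegative orthant. If `suc d < m`, the point `χ F`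
  -- and its translates by `suc (suc d)` unit vectors are affinely independent, one point more than
  -- dimension `suc d` allows.
  edges≤dimension : ∀ {F d} → SteinerCut G F → HasDimension (CUT₊ G) (suc d) → m ℕ.≤ suc d
  edges≤dimension {F} {d} cut (_ , dependent) = ℕ.≮⇒≥ λ d<m → simplex (λ j → inject≤ j d<m)
    (λ j l → Fin.inject≤-injective d<m d<m j l)
    where
    simplex : (ι : Fin (suc (suc d)) → Fin m) → (∀ j l → ι j ≡ ι l → j ≡ l) → ⊥
    simplex ι ι-injective = dependent (λ j e → χ F e Defs.+ corner units j e)
      (λ j → steinerCut+nonNeg cut (corner units j) (0≤corner j))
      λ a Σa≃0 Σ≃0 j → unwrap (corner-independent (χ F) units ι diagonal off-diagonal
        a (wrap Σa≃0) (λ i → wrap (Σ≃0 i)) j)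
      where
      units : Vector (Vector ℝ m) (suc (suc d))
      units j = χ ⁅ ι j ⁆

      0≤corner : ∀ j e → 0≤ corner units j e
      0≤corner zero    e = 0≤fromℕ 0
      0≤corner (suc j) e = subst 0≤_ (sym (χ≡fromℕ ⁅ ι j ⁆ e)) (0≤fromℕ (bit (lookup ⁅ ι j ⁆ e)))

      diagonal : ∀ j → units j (ι j) ≈ 1ℝ
      diagonal j rewrite []=⇒lookup (x∈⁅x⁆ (ι j)) = R.refl {1ℝ}

      off-diagonal : ∀ j l → j ≢ l → units j (ι l) ≈ 0ℝ
      off-diagonal j l j≢l
        rewrite ∉⇒lookup {p = ⁅ ι j ⁆} (x≢y⇒x∉⁅y⁆ (λ l≡j → j≢l (sym (ι-injective l j l≡j)))) =
        R.refl {0ℝ}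

  -- By `face-point` the nonnegative slack and the coefficients of all cuts heavier than `γ` vanish,
  -- which leaves a combination of minimum cuts.
  face-span : ∀ (c : Vector ℕ m) {γ} → (∀ e → 0 ℕ.< c e) →
    (∀ F → SteinerCut G F → γ ℕ.≤ weight c F) →
    ∀ gs → (∀ {F} → SteinerCut G F → weight c F ≡ γ → Span gs (χ F)) →
    ∀ {x} → CUT₊ G x → c · x Defs.≃ fromℕ γ → Span gs x
  face-span c {γ} c>0 γ≤ gs span {x} (y , r , (k , p , a , cuts , 0≤a , Σa≃1 , y≃) , 0≤r , x≃) tight =
    span-cong gs (λ e → R.sym (x≈Σ e)) (span-sum gs a p λ j → Sum.map₁ (on-cut j) (proj₁ tightness j))
    where
    cutOf : ∀ j → Subset m
    cutOf j = proj₁ (cuts j)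

    x≈ : ∀ e → x e ≈ combination a p e Defs.+ r e
    x≈ e = R.trans {x e} {y e Defs.+ r e} (wrap (x≃ e)) (R.+-congʳ {r e} {y e} (wrap (y≃ e)))

    tightness = face-point c γ (λ j → weight c (cutOf j)) a p r x c>0
      (λ j → γ≤ (cutOf j) (proj₁ (proj₂ (cuts j))))
      (λ j → R.trans {dot c (p j)} {dot c (χ (cutOf j))}
        (dot-cong c (λ e → wrap (proj₂ (proj₂ (cuts j)) e))) (dot-χ c (cutOf j)))
      (λ j → nonNeg (0≤a j)) (wrap Σa≃1) (λ e → nonNeg (0≤r e)) x≈ (wrap tight)

    x≈Σ : ∀ e → x e ≈ combination a p e
    x≈Σ e = R.trans {x e} (x≈ e) (R.trans {combination a p e Defs.+ r e}
      (R.+-congˡ {combination a p e} (proj₂ tightness e)) (R.+-identityʳ (combination a p e)))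

    on-cut : ∀ j → weight c (cutOf j) ≡ γ → Span gs (p j)
    on-cut j w≡γ = span-cong gs (λ e → R.sym {p j e} (wrap (proj₂ (proj₂ (cuts j)) e)))
      (span (proj₁ (proj₂ (cuts j))) w≡γ)

  minimumCuts-span : ∀ (c : Vector ℕ m) {γ} → (∀ e → 0 ℕ.< c e) →
    (∀ F → SteinerCut G F → γ ℕ.≤ weight c F) →
    ∃[ gs ] (length gs ≡ n ℕ.+ ∣ T ∣ × (∀ {F} → SteinerCut G F → weight c F ≡ γ → Span gs (χ F)))
  minimumCuts-span c {γ} c>0 γ≤ with nonempty? T
  ... | no ∅ = contradiction ∣T∣≥2
    (subst (λ k → ¬ (2 ℕ.≤ k)) (sym (trans (cong ∣_∣ (Empty-unique ∅)) (∣⊥∣≡0 n))) λ ())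
  ... | yes (r , r∈T) with maximal-laminar (MinimumCuts.minimum? G c c>0 γ γ≤ r r∈T) (allSubsets n)
  ...   | L , L⊆M , lam , max = gs
    , trans (length-map (χ ∘ δ) (representatives T L)) (length-representatives T L)
    , λ cut wF → spans (rooted cut wF)
    where
    open MinimumCuts G c c>0 γ γ≤ r r∈T

    -- Taken over the representatives, whose number is known, instead of over `L`; entries outside
    -- `L` can only enlarge the span.
    gs : List (Vector ℝ m)
    gs = map (χ ∘ δ) (representatives T L)

    uncrosses : Uncrosses Minimum (λ S → Span gs (χ (δ S)))
    uncrosses {S} {X} MS MX spanX _ = Sum.map
      (λ (M∩ , M∪ , bal) → M∩ , M∪ , λ s t → solve {S ∩ X} {S ∪ X} bal s t)
      (λ (M─ˡ , M─ʳ , bal) → M─ˡ , M─ʳ , λ s t → solve {S ─ X} {X ─ S} bal s t)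
      (uncross MS MX)
      where
      solve : ∀ {A B} → Balanced S X A B → Span gs (χ (δ A)) → Span gs (χ (δ B)) → Span gs (χ (δ S))
      solve {A} {B} bal = span-solve gs {u = χ (δ S)} (χ-balance (δ S) (δ X) (δ A) (δ B) bal) spanX

    spans : ∀ {F} → (∃[ S ] (Minimum S × δ S ≡ F)) → Span gs (χ F)
    spans (S , MS , refl) = laminar-generates {P = λ S → Span gs (χ (δ S))} lam L⊆M
      (λ S∈L → span-∈ {gs = gs} (∈-map⁺ (χ ∘ δ)
        (laminar-representatives T lam (λ S∈ → proj₁ (proj₂ (L⊆M S∈))) S∈L)))
      uncrosses (λ {S} → max (∈-allSubsets S)) MS

  -- The facet carries `suc d` affinely independent points, where `m ≤ suc d`. They are linearly
  -- independent because `γ` is positive, and they lie in the span of `n + ∣ T ∣` vectors.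
  facet-edges≤ : FacetInducing G → m ℕ.≤ n ℕ.+ ∣ T ∣
  facet-edges≤ (c , _ , c>0 , γ , ((F , cut , _) , γ≤) , 0<γ , _ , d , dimP , (x , x∈ , ind) , _)
    with minimumCuts-span c c>0 γ≤
  ... | gs , length-gs , span = ℕ.≤-trans (edges≤dimension cut dimP) (subst (suc d ℕ.≤_) length-gs
    (independent⇒≤ gs x (λ j → face-span c c>0 γ≤ gs span (proj₁ (x∈ j)) (proj₂ (x∈ j)))
      (affine⇒linear c x 0<γ (λ j → wrap (proj₂ (x∈ j)))
        λ a Σa≈0 Σ≈0 j → wrap (ind a (unwrap Σa≈0) (λ i → unwrap (Σ≈0 i)) j))))

theorem4 : Σ (ℕ → ℕ) λ f →
    (τ : ℕ) → 2 ≤ℕ τ →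
    (Gs : List SteinerGraph) →
    All (λ G → FacetInducing G × Irreducible G × ∣ SteinerGraph.T G ∣ ≡ τ) Gs →
    AllPairs (λ G H → ¬ (G ≅ H)) Gs →
    length Gs ≤ℕ f τ
theorem4 = (λ τ → codes (5 ℕ.* τ)) , λ τ _ Gs hyps distinct →
  ≇-length≤ (5 ℕ.* τ) Gs (All.map (λ {G} hyp → small G hyp) hyps) distinct
  where
  small : ∀ {τ} G → FacetInducing G × Irreducible G × ∣ SteinerGraph.T G ∣ ≡ τ →
          SteinerGraph.n G ≤ℕ 5 ℕ.* τ
  small G (facet , irreducible , refl) = nodes≤ G irreducible (facet-edges≤ G facet)
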